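{- Let $\mathcal P$ and $\mathcal Q$ be chiral or directly regular polyhedra. Then $\mathcal P \diamond \mathcal Q$ is a chiral or directly regular polyhedron.
   Context: An abstract polytope of rank $n$ (an $n$-polytope; a polyhedron is a $3$-polytope) is a ranked poset of faces with ranks from $-1$ to $n$, with a unique least face (rank $-1$) and a unique greatest face (rank $n$), in which every flag (maximal chain) has $n+2$ faces, which satisfies the diamond condition (whenever $F<G$ with ranks $j-1$ and $j+1$ there are exactly two $j$-faces strictly between them), and which is strongly flag-connected (any two flags $\Phi,\Psi$ are joined by a sequence of flags, consecutive ones adjacent, all containing $\Phi\cap\Psi$; two flags are adjacent if they differ in exactly one face). $\Phi^j$ denotes the unique flag differing from $\Phi$ only in its $j$-face, and $\Phi^{i,j}=(\Phi^i)^j$. Each polytope considered has a fixed base flag $\Phi$. $\mathcal P$ is regular if its automorphism group $\Gamma(\mathcal P)$ is transitive on flags; then $\Gamma(\mathcal P)$ is generated by $\rho_0,\dots,\rho_{n-1}$, where $\rho_i$ maps $\Phi$ to $\Phi^i$. Put $\sigma_i=\rho_{i-1}\rho_i$ and $\Gamma^+(\mathcal P)=\langle\sigma_1,\dots,\sigma_{n-1}\rangle$; $\mathcal P$ is directly regular if it is regular and $\Gamma^+(\mathcal P)$ has index $2$ in $\Gamma(\mathcal P)$. $\mathcal P$ is chiral if $\Gamma(\mathcal P)$ has exactly two orbits on flags and adjacent flags lie in distinct orbits; then $\Gamma^+(\mathcal P):=\Gamma(\mathcal P)$ is generated by $\sigma_1,\dots,\sigma_{n-1}$, where $\sigma_i$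 maps $\Phi$ to $\Phi^{i,i-1}$. In both cases $(\sigma_i\cdots\sigma_j)^2=1$ for $i<j$. Intersection property: for a group $G$ with specified generators $\sigma_1,\dots,\sigma_{n-1}$, put $\tau_{i,j}=\sigma_i\cdots\sigma_j$ ($1\le i\le j\le n-1$) and, for $I\subseteq\{0,\dots,n-1\}$, $G_I=\langle\tau_{i,j}\mid i\le j,\ i-1,j\in I\rangle$. $G$ has the intersection property if $G_I\cap G_J=G_{I\cap J}$ for all $I,J\subseteq\{0,\dots,n-1\}$. Known facts: rotation groups $\Gamma^+(\mathcal P)$ of chiral or directly regular $n$-polytopes have the intersection property; conversely, a group generated by $\sigma_1,\dots,\sigma_{n-1}$ with $(\sigma_i\cdots\sigma_j)^2=1$ for $i<j$ and with the intersection property is the rotation group of a chiral or directly regular $n$-polytope. For $n=3$ the intersection property amounts to $\langle\sigma_1\rangle\cap\langle\sigma_2\rangle=\{1\}$. Mix: for $\Gamma^+(\mathcal P)=\langle\sigma_1,\dots,\sigma_{n-1}\rangle$ and $\Gamma^+(\mathcal Q)=\langle\sigma_1',\dots,\sigma_{n-1}'\rangle$, the mix $\Gamma^+(\mathcal P)\diamond\Gamma^+(\mathcal Q)$ is the subgroup of the direct product generated by $\beta_i=(\sigma_i,\sigma_i')$. $\mathcal P\diamond\mathcal Q$ denotes the chiral or directly regular flag-connected pre-polytope (i.e. polytope axioms with strong flag-connectedness weakened to flag-connectedness) built from this group with generators $\beta_1,\dots,\beta_{n-1}$, so $\Gamma^+(\mathcal P\diamond\mathcal Q)=\Gamma^+(\mathcal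 P)\diamond\Gamma^+(\mathcal Q)$; it is a polytope if and only if this group, with generators $\beta_i$, has the intersection property, in which case it is the chiral or directly regular $n$-polytope with this rotation group. -}

module Defs where

open import Level using (Level) renaming (suc to lsuc; zero to 0ℓ)
open import Algebra.Bundles using (Group)
import Algebra.Construct.DirectProduct as DirectProduct
open import Data.Empty using (⊥-elim)
open import Data.Fin.Base as Fin using (Fin; zero; suc; toℕ; fromℕ; inject₁)
open import Data.Fin.Properties as Fin using (toℕ-inject₁; _≟_)
open import Data.Fin.Relation.Unary.Top using (view; ‵fromℕ; ‵inject₁)
open import Data.Nat.Base as ℕ using (ℕ; zero; suc)
import Data.Nat.Properties as ℕ
open import Data.Product.Base using (Σ; Σ-syntax; ∃; ∃-syntax; _×_; _,_; proj₁; proj₂)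
open import Data.Sum.Base using (_⊎_; inj₁; inj₂)
open import Data.Vec.Functional using (updateAt)
open import Data.Vec.Functional.Properties using (updateAt-updates; updateAt-minimal)
open import Function.Base using (_∘_; const; id)
open import Function.Bundles using (_⇔_)
open import Relation.Binary.Core using (Rel)
open import Relation.Binary.Structures using (IsPartialOrder)
open import Relation.Binary.Construct.Closure.ReflexiveTransitive using (Star)
import Relation.Binary.Morphism.Construct.Composition as Composition
import Relation.Binary.Morphism.Construct.Identity as Identity
open import Relation.Binary.Morphism.Structures using (IsOrderIsomorphism)
open import Relation.Binary.PropositionalEquality.Core as ≡ using (_≡_; _≢_; refl; cong; subst; subst₂)
open import Relation.Nullary.Decidable.Core using (yes; no)
open import Relation.Nullary.Negation.Core using (¬_)
open import Relation.Unary using (Pred; _⊆_)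

-- A rank r ∈ {-1, …, n} is represented by the element r + 1 of Fin (2 + n).

record RankedStructure (n : ℕ) (ℓ : Level) : Set (lsuc ℓ) where
  infix 4 _≈_ _≤_ _<_
  field
    Face : Set ℓ
    _≈_  : Rel Face ℓ
    _≤_  : Rel Face ℓ
    rank : Face → Fin (2 ℕ.+ n)

  _<_ : Rel Face ℓ
  F < G = F ≤ G × ¬ (F ≈ G)

-- For a proper rank j, the positions in Fin (2 + n) of the ranks j, j - 1, j + 1.

at below above : ∀ {n} → Fin n → Fin (2 ℕ.+ n)
at    j = suc (inject₁ j)
below j = inject₁ (inject₁ j)
above j = suc (suc j)

module _ {n : ℕ} {ℓ : Level} (S : RankedStructure n ℓ) where
  open RankedStructure S

  IsChain : Pred Face ℓ → Set ℓ
  IsChain C = ∀ F G → C F → C G → F ≤ G ⊎ G ≤ F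

  record IsMaximalChain (C : Pred Face ℓ) : Set (lsuc ℓ) where
    field
      isChain : IsChain C
      maximal : ∀ (D : Pred Face ℓ) → IsChain D → C ⊆ D → D ⊆ C

  -- A chain with exactly n + 2 faces, listed by rank. The polytope axiom
  -- `flags` below says that all maximal chains are of this form.
  record Flag : Set ℓ where
    field
      face      : Fin (2 ℕ.+ n) → Face
      rank-face : ∀ i → rank (face i) ≡ i
      mono      : ∀ {i j} → i Fin.≤ j → face i ≤ face j

  open Flag

  infix 4 _∈ᶠ_ _≈ᶠ_

  _∈ᶠ_ : Face → Flag → Set ℓ
  F ∈ᶠ Φ = ∃[ i ] F ≈ face Φ i

  _≈ᶠ_ : Rel Flag ℓ
  Φ ≈ᶠ Ψ = ∀ i → face Φ i ≈ face Ψ i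

  Adjacent : Rel Flag ℓ
  Adjacent Φ Ψ = ∃[ j ] ¬ (face Φ j ≈ face Ψ j) × (∀ i → i ≢ j → face Φ i ≈ face Ψ i)

  Contains-∩ : Flag → Flag → Flag → Set ℓ
  Contains-∩ Φ Ψ X = ∀ F → F ∈ᶠ Φ → F ∈ᶠ Ψ → F ∈ᶠ X

  -- Flags are compared up to _≈ᶠ_, hence the sequence ends at some Ψ′ ≈ᶠ Ψ.
  StronglyConnected : Rel Flag ℓ
  StronglyConnected Φ Ψ =
    ∃[ Ψ′ ] Star (λ X Y → Adjacent X Y × Contains-∩ Φ Ψ Y) Φ Ψ′ × Ψ′ ≈ᶠ Ψ

  record IsPolytope : Set (lsuc ℓ) where
    field
      isPartialOrder : IsPartialOrder _≈_ _≤_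
      rank-cong      : ∀ {F G} → F ≈ G → rank F ≡ rank G
      rank-strict    : ∀ {F G} → F < G → rank F Fin.< rank G
      least          : ∃[ F ] rank F ≡ zero × (∀ G → F ≤ G)
      greatest       : ∃[ F ] rank F ≡ fromℕ (suc n) × (∀ G → G ≤ F)
      flags          : ∀ (C : Pred Face ℓ) → IsMaximalChain C →
                       ∃[ Φ ] (∀ F → C F ⇔ F ∈ᶠ Φ)

    Between : Fin n → Face → Face → Pred Face ℓ
    Between j F G H = rank H ≡ at j × F < H × H < G

    field
      diamond : ∀ j {F G} → rank F ≡ below j → rank G ≡ above j → F < G →
                ∃[ A ] ∃[ B ] Between j F G A × Between j F G B × ¬ (A ≈ B) ×
                              (∀ H → Between j F G H → H ≈ A ⊎ H ≈ B)
      stronglyFlagConnected : ∀ Φ Ψ → StronglyConnected Φ Ψ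

    open IsPartialOrder isPartialOrder public
      using (module Eq; antisym)
      renaming (refl to ≤-refl; trans to ≤-trans; reflexive to ≤-reflexive)

  record Automorphism : Set ℓ where
    field
      to                 : Face → Face
      isOrderIsomorphism : IsOrderIsomorphism _≈_ _≈_ _≤_ _≤_ to
    open IsOrderIsomorphism isOrderIsomorphism public
      renaming (cong to to-cong; mono to to-mono)

  Maps : Automorphism → Rel Flag ℓ
  Maps γ Φ Ψ = ∀ i → Automorphism.to γ (face Φ i) ≈ face Ψ i

  SameOrbit : Rel Flag ℓ
  SameOrbit Φ Ψ = ∃[ γ ] Maps γ Φ Ψ

record Polytope (n : ℕ) (ℓ : Level) : Set (lsuc ℓ) where
  constructor polytope
  field
    structure  : RankedStructure n ℓ
    isPolytope : IsPolytope structure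
  open RankedStructure structure public
  open IsPolytope isPolytope public

Polyhedron : (ℓ : Level) → Set (lsuc ℓ)
Polyhedron = Polytope 3

module _ {ℓ : Level} (G : Group ℓ ℓ) where
  open Group G renaming (refl to ≈-refl; trans to ≈-trans)

  data Generated {I : Set} (g : I → Carrier) : Pred Carrier ℓ where
    gen  : ∀ i → Generated g (g i)
    unit : Generated g ε
    mul  : ∀ {x y} → Generated g x → Generated g y → Generated g (x ∙ y)
    inv  : ∀ {x} → Generated g x → Generated g (x ⁻¹)
    resp : ∀ {x y} → x ≈ y → Generated g x → Generated g y

  -- Membership of x in the right coset H g.
  _∈[_∙_] : Carrier → Pred Carrier ℓ → Carrier → Set ℓ
  x ∈[ H ∙ g ] = H (x ∙ g ⁻¹)

  HasIndex : Pred Carrier ℓ → ℕ → Set ℓ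
  HasIndex H k = Σ[ t ∈ (Fin k → Carrier) ]
    (∀ x → ∃[ i ] x ∈[ H ∙ t i ]) × (∀ i j → t i ∈[ H ∙ t j ] → i ≡ j)

  generatedGroup : {I : Set} → (I → Carrier) → Group ℓ ℓ
  generatedGroup g = record
    { Carrier = ∃ (Generated g)
    ; _≈_     = λ x y → proj₁ x ≈ proj₁ y
    ; _∙_     = λ x y → proj₁ x ∙ proj₁ y , mul (proj₂ x) (proj₂ y)
    ; ε       = ε , unit
    ; _⁻¹     = λ x → proj₁ x ⁻¹ , inv (proj₂ x)
    ; isGroup = record
      { isMonoid = record
        { isSemigroup = record
          { isMagma = record
            { isEquivalence = record { refl = ≈-refl ; sym = sym ; trans = ≈-trans }
            ; ∙-cong        = ∙-cong
            }
          ; assoc = λ x y z → assoc (proj₁ x) (proj₁ y) (proj₁ z)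
          }
        ; identity = (λ x → identityˡ (proj₁ x)) , (λ x → identityʳ (proj₁ x))
        }
      ; inverse = (λ x → inverseˡ (proj₁ x)) , (λ x → inverseʳ (proj₁ x))
      ; ⁻¹-cong = ⁻¹-cong
      }
    }

module _ {n : ℕ} {ℓ : Level} (P : Polytope n ℓ) where
  open Polytope P
  open Automorphism

  private
    S = structure

    inverse : Automorphism S → Automorphism S
    inverse γ = record
      { to = f
      ; isOrderIsomorphism = record
        { isOrderMonomorphism = record
          { isOrderHomomorphism = record
            { cong = λ {x} {y} x≈y → injective γ
                (Eq.trans (right x) (Eq.trans x≈y (Eq.sym (right y))))
            ; mono = λ {x} {y} x≤y → cancel γ
                (≤-trans (≤-reflexive (right x)) (≤-trans x≤y (≤-reflexive (Eq.sym (right y)))))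
            }
          ; injective = λ {x} {y} e →
              Eq.trans (Eq.sym (right x)) (Eq.trans (to-cong γ e) (right y))
          ; cancel = λ {x} {y} e →
              ≤-trans (≤-reflexive (Eq.sym (right x)))
                (≤-trans (to-mono γ e) (≤-reflexive (right y)))
          }
        ; surjective = λ y → to γ y , λ {z} z≈ → injective γ (Eq.trans (right z) z≈)
        }
      }
      where
      f : Face → Face
      f y = proj₁ (surjective γ y)
      right : ∀ y → to γ (f y) ≈ y
      right y = proj₂ (surjective γ y) Eq.refl

  -- Automorphisms act on the right: α ∙ β is α followed by β.
  Γ : Group ℓ ℓ
  Γ = record
    { Carrier = Automorphism S
    ; _≈_     = λ α β → ∀ F → to α F ≈ to β F
    ; _∙_     = λ α β → record
      { to = to β ∘ to α
      ; isOrderIsomorphism = Composition.isOrderIsomorphism Eq.trans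
          (isOrderIsomorphism α) (isOrderIsomorphism β)
      }
    ; ε       = record
      { to = id ; isOrderIsomorphism = Identity.isOrderIsomorphism _≈_ _≤_ Eq.refl }
    ; _⁻¹     = inverse
    ; isGroup = record
      { isMonoid = record
        { isSemigroup = record
          { isMagma = record
            { isEquivalence = record
              { refl  = λ F → Eq.refl
              ; sym   = λ p F → Eq.sym (p F)
              ; trans = λ p q F → Eq.trans (p F) (q F)
              }
            ; ∙-cong = λ {_} {α′} {β} p q F → Eq.trans (to-cong β (p F)) (q (to α′ F))
            }
          ; assoc = λ α β γ F → Eq.refl
          }
        ; identity = (λ α F → Eq.refl) , (λ α F → Eq.refl)
        }
      ; inverse = (λ α F → proj₂ (surjective α F) Eq.refl)
                , (λ α F → injective α (proj₂ (surjective α (to α F)) Eq.refl))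
      ; ⁻¹-cong = λ {α} {β} p F → injective β
          (Eq.trans (Eq.sym (p _))
            (Eq.trans (proj₂ (surjective α F) Eq.refl)
                      (Eq.sym (proj₂ (surjective β F) Eq.refl))))
      }
    }

  private
    open Flag

    module Replace (Φ : Flag S) (j : Fin n) where
      F G : Face
      F = face Φ (below j)
      G = face Φ (above j)

      ≢⇒≉ : ∀ {i k} → i ≢ k → ¬ (face Φ i ≈ face Φ k)
      ≢⇒≉ {i} {k} i≢k e =
        i≢k (≡.trans (≡.sym (rank-face Φ i)) (≡.trans (rank-cong e) (rank-face Φ k)))

      toℕ-below : toℕ (below j) ≡ toℕ j
      toℕ-below = ≡.trans (toℕ-inject₁ (inject₁ j)) (toℕ-inject₁ j)

      toℕ-at : toℕ (at j) ≡ suc (toℕ j)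
      toℕ-at = cong suc (toℕ-inject₁ j)

      toℕ< : ∀ {i k : Fin (2 ℕ.+ n)} → toℕ i ℕ.< toℕ k → i ≢ k
      toℕ< i<k refl = ℕ.<-irrefl refl i<k

      below<at : toℕ (below j) ℕ.< toℕ (at j)
      below<at = subst₂ ℕ._<_ (≡.sym toℕ-below) (≡.sym toℕ-at) ℕ.≤-refl

      at<above : toℕ (at j) ℕ.< toℕ (above j)
      at<above = subst (ℕ._< toℕ (above j)) (≡.sym toℕ-at) ℕ.≤-refl

      F<G : F < G
      F<G = mono Φ (ℕ.<⇒≤ below<above) , ≢⇒≉ (toℕ< below<above)
        where below<above = ℕ.<-trans below<at at<above

      current : Between j F G (face Φ (at j))
      current = rank-face Φ (at j)
              , (mono Φ (ℕ.<⇒≤ below<at) , ≢⇒≉ (toℕ< below<at))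
              , (mono Φ (ℕ.<⇒≤ at<above) , ≢⇒≉ (toℕ< at<above))

      other : ∃[ H ] Between j F G H × ¬ (face Φ (at j) ≈ H)
      other with diamond j (rank-face Φ (below j)) (rank-face Φ (above j)) F<G
      ... | A , B , A∈ , B∈ , A≉B , only with only (face Φ (at j)) current
      ... | inj₁ ≈A = B , B∈ , λ ≈B → A≉B (Eq.trans (Eq.sym ≈A) ≈B)
      ... | inj₂ ≈B = A , A∈ , λ ≈A → A≉B (Eq.trans (Eq.sym ≈A) ≈B)

      H : Face
      H = proj₁ other

      new : Fin (2 ℕ.+ n) → Face
      new = updateAt (face Φ) (at j) (const H)

      new-at : new (at j) ≡ H
      new-at = updateAt-updates (at j) (face Φ)

      new-else : ∀ i → i ≢ at j → new i ≡ face Φ i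
      new-else i i≢ = updateAt-minimal i (at j) (face Φ) i≢

      rank-new : ∀ i → rank (new i) ≡ i
      rank-new i with i ≟ at j
      ... | yes refl = ≡.trans (cong rank new-at) (proj₁ (proj₁ (proj₂ other)))
      ... | no  i≢   = ≡.trans (cong rank (new-else i i≢)) (rank-face Φ i)

      mono-new : ∀ {i k} → i Fin.≤ k → new i ≤ new k
      mono-new {i} {k} i≤k with i ≟ at j | k ≟ at j
      ... | yes refl | yes refl = ≤-refl
      ... | yes refl | no k≢ =
        subst₂ _≤_ (≡.sym new-at) (≡.sym (new-else k k≢))
          (≤-trans (proj₁ (proj₂ (proj₂ (proj₁ (proj₂ other))))) (mono Φ above≤k))
        where
        above≤k : toℕ (above j) ℕ.≤ toℕ k
        above≤k = subst (λ a → suc a ℕ.≤ toℕ k) toℕ-at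
          (ℕ.≤∧≢⇒< i≤k (λ e → k≢ (≡.sym (Fin.toℕ-injective e))))
      ... | no i≢ | yes refl =
        subst₂ _≤_ (≡.sym (new-else i i≢)) (≡.sym new-at)
          (≤-trans (mono Φ i≤below) (proj₁ (proj₁ (proj₂ (proj₁ (proj₂ other))))))
        where
        i≤below : toℕ i ℕ.≤ toℕ (below j)
        i≤below = subst (toℕ i ℕ.≤_) (≡.sym toℕ-below)
          (ℕ.s≤s⁻¹ (subst (toℕ i ℕ.<_) toℕ-at
            (ℕ.≤∧≢⇒< i≤k (λ e → i≢ (Fin.toℕ-injective e)))))
      ... | no i≢ | no k≢ =
        subst₂ _≤_ (≡.sym (new-else i i≢)) (≡.sym (new-else k k≢)) (mono Φ i≤k)

  infixl 8 _^_

  _^_ : Flag S → Fin n → Flag S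
  Φ ^ j = record { face = new ; rank-face = rank-new ; mono = mono-new }
    where open Replace Φ j

  ^-differs : ∀ Φ j → ¬ (face Φ (at j) ≈ face (Φ ^ j) (at j))
  ^-differs Φ j e = proj₂ (proj₂ other) (subst (face Φ (at j) ≈_) new-at e)
    where open Replace Φ j

  ^-agrees : ∀ Φ j i → i ≢ at j → face Φ i ≈ face (Φ ^ j) i
  ^-agrees Φ j i i≢ = Eq.reflexive (≡.sym (Replace.new-else Φ j i i≢))

  ^-adjacent : ∀ Φ j → Adjacent S Φ (Φ ^ j)
  ^-adjacent Φ j = at j , ^-differs Φ j , ^-agrees Φ j

  Regular : Set ℓ
  Regular = ∀ Φ Ψ → SameOrbit S Φ Ψ

  record Chiral : Set ℓ where
    field
      orbit₁ orbit₂    : Flag S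
      orbits-distinct  : ¬ SameOrbit S orbit₁ orbit₂
      orbits-cover     : ∀ Ψ → SameOrbit S orbit₁ Ψ ⊎ SameOrbit S orbit₂ Ψ
      adjacent-differ  : ∀ Φ Ψ → Adjacent S Φ Ψ → ¬ SameOrbit S Φ Ψ

module _ {m : ℕ} {ℓ : Level} (P : Polytope (suc m) ℓ) (Φ : Flag (Polytope.structure P)) where
  open Polytope P
  open Flag
  open Automorphism

  private
    S = structure
    module G = Group (Γ P)

  -- An index k : Fin m stands for the subscript k + 1 of σ.

  ρ : Regular P → Fin (suc m) → Automorphism S
  ρ reg i = proj₁ (reg Φ (_^_ P Φ i))

  σ-regular : Regular P → Fin m → Automorphism S
  σ-regular reg k = ρ reg (inject₁ k) G.∙ ρ reg (suc k)

  record DirectlyRegular : Set ℓ where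
    field
      regular : Regular P
      index-2 : HasIndex (Γ P) (Generated (Γ P) (σ-regular regular)) 2

  private
    orbit-sym : ∀ X Y → SameOrbit S X Y → SameOrbit S Y X
    orbit-sym X Y (γ , p) = γ G.⁻¹ ,
      λ i → injective γ (Eq.trans (proj₂ (surjective γ _) Eq.refl) (Eq.sym (p i)))

    joint-orbit : ∀ A X Y → SameOrbit S A X → SameOrbit S A Y → SameOrbit S X Y
    joint-orbit A X Y p (δ , q) with orbit-sym A X p
    ... | γ , p⁻¹ = γ G.∙ δ , λ i → Eq.trans (to-cong δ (p⁻¹ i)) (q i)

    two-steps : Chiral P → ∀ X Y Z → Adjacent S X Y → Adjacent S Y Z → SameOrbit S X Z
    two-steps ch X Y Z XY YZ = go (orbits-cover X) (orbits-cover Y) (orbits-cover Z)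
      where
      open Chiral ch
      Orbits = λ W → SameOrbit S orbit₁ W ⊎ SameOrbit S orbit₂ W
      go : Orbits X → Orbits Y → Orbits Z → SameOrbit S X Z
      go (inj₁ x) _ (inj₁ z) = joint-orbit orbit₁ X Z x z
      go (inj₂ x) _ (inj₂ z) = joint-orbit orbit₂ X Z x z
      go (inj₁ x) (inj₁ y) _ = ⊥-elim (adjacent-differ X Y XY (joint-orbit orbit₁ X Y x y))
      go (inj₂ x) (inj₂ y) _ = ⊥-elim (adjacent-differ X Y XY (joint-orbit orbit₂ X Y x y))
      go _ (inj₁ y) (inj₁ z) = ⊥-elim (adjacent-differ Y Z YZ (joint-orbit orbit₁ Y Z y z))
      go _ (inj₂ y) (inj₂ z) = ⊥-elim (adjacent-differ Y Z YZ (joint-orbit orbit₂ Y Z y z))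

  chiral-rotation : Chiral P → (k : Fin m) →
    SameOrbit S Φ (_^_ P (_^_ P Φ (suc k)) (inject₁ k))
  chiral-rotation ch k = two-steps ch Φ Φ₁ (_^_ P Φ₁ (inject₁ k))
    (^-adjacent P Φ (suc k)) (^-adjacent P Φ₁ (inject₁ k))
    where Φ₁ = _^_ P Φ (suc k)

  σ-chiral : Chiral P → Fin m → Automorphism S
  σ-chiral ch k = proj₁ (chiral-rotation ch k)

  ChiralOrDirectlyRegular : Set ℓ
  ChiralOrDirectlyRegular = Chiral P ⊎ DirectlyRegular

  Γ⁺ : ChiralOrDirectlyRegular → Group ℓ ℓ
  Γ⁺ (inj₁ ch) = Γ P
  Γ⁺ (inj₂ dr) = generatedGroup (Γ P) (σ-regular (DirectlyRegular.regular dr))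

  σ : (h : ChiralOrDirectlyRegular) → Fin m → Group.Carrier (Γ⁺ h)
  σ (inj₁ ch) k = σ-chiral ch k
  σ (inj₂ dr) k = σ-regular (DirectlyRegular.regular dr) k , gen k

module _ {ℓ : Level} (G : Group ℓ ℓ) where
  open Group G using (Carrier; _∙_; ε)

  product-upTo : ∀ {m} → (Fin m → Carrier) → Fin m → Carrier
  product-upTo s zero    = s zero
  product-upTo s (suc k) = s zero ∙ product-upTo (s ∘ suc) k

  -- τ s i k = s i ∙ ⋯ ∙ s k for i ≤ k; the value for i > k is not used.
  τ : ∀ {m} → (Fin m → Carrier) → Fin m → Fin m → Carrier
  τ s zero    k       = product-upTo s k
  τ s (suc i) zero    = ε
  τ s (suc i) (suc k) = τ (s ∘ suc) i k

  -- With the index shift for σ, the condition "i - 1, k ∈ I" on τ_{i,k} becomes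
  -- "inject₁ i, suc k ∈ I".
  TauIndex : ∀ {m} → Pred (Fin (suc m)) 0ℓ → Set
  TauIndex {m} I = Σ[ i ∈ Fin m ] Σ[ k ∈ Fin m ] (i Fin.≤ k × I (inject₁ i) × I (suc k))

  Subgroup : ∀ {m} → (Fin m → Carrier) → Pred (Fin (suc m)) 0ℓ → Pred Carrier ℓ
  Subgroup s I = Generated G {TauIndex I} (λ (i , k , _) → τ s i k)

  -- The coset geometry of Schulte and Weiss, of rank n = 3 + r ≥ 3. The proper
  -- j-faces are the right cosets of G_{N ∖ {j}}, where N = {0, …, n - 1}, and
  -- faces of ranks i ≤ j are incident when the cosets meet. (In rank 2 this
  -- incidence relation would be too small.)
  module CosetGeometry {r : ℕ} (s : Fin (2 ℕ.+ r) → Carrier) where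

    Stab : Fin (3 ℕ.+ r) → Pred Carrier ℓ
    Stab j = Subgroup s (_≢ j)

    data CosetFace : Set ℓ where
      bottom top : CosetFace
      coset      : Fin (3 ℕ.+ r) → Carrier → CosetFace

    data _≈ᶜ_ : Rel CosetFace ℓ where
      bottom≈ : bottom ≈ᶜ bottom
      top≈    : top ≈ᶜ top
      coset≈  : ∀ {j g h} → _∈[_∙_] G g (Stab j) h → coset j g ≈ᶜ coset j h

    data _≤ᶜ_ : Rel CosetFace ℓ where
      bottom≤ : ∀ {F} → bottom ≤ᶜ F
      ≤top    : ∀ {F} → F ≤ᶜ top
      coset≤  : ∀ {i j g h} → i Fin.≤ j →
                ∃[ x ] _∈[_∙_] G x (Stab i) g × _∈[_∙_] G x (Stab j) h →
                coset i g ≤ᶜ coset j h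

    rankᶜ : CosetFace → Fin (5 ℕ.+ r)
    rankᶜ bottom      = zero
    rankᶜ (coset j g) = at j
    rankᶜ top         = fromℕ (4 ℕ.+ r)

    cosetStructure : RankedStructure (3 ℕ.+ r) ℓ
    cosetStructure = record { Face = CosetFace ; _≈_ = _≈ᶜ_ ; _≤_ = _≤ᶜ_ ; rank = rankᶜ }

    private
      ε∈ : ∀ j → _∈[_∙_] G ε (Stab j) ε
      ε∈ j = resp (Group.sym G (Group.inverseʳ G ε)) unit

    baseFace : Fin (5 ℕ.+ r) → CosetFace
    baseFace zero    = bottom
    baseFace (suc i) with view i
    ... | ‵fromℕ     = top
    ... | ‵inject₁ j = coset j ε

    private
      rank-baseFace : ∀ i → rankᶜ (baseFace i) ≡ i
      rank-baseFace zero    = refl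
      rank-baseFace (suc i) with view i
      ... | ‵fromℕ     = refl
      ... | ‵inject₁ j = refl

      mono-baseFace : ∀ {i k} → i Fin.≤ k → baseFace i ≤ᶜ baseFace k
      mono-baseFace {zero}  {k}     _   = bottom≤
      mono-baseFace {suc i} {suc k} i≤k with view i | view k
      ... | _          | ‵fromℕ     = ≤top
      ... | ‵inject₁ j | ‵inject₁ l = coset≤
        (subst₂ ℕ._≤_ (toℕ-inject₁ j) (toℕ-inject₁ l) (ℕ.s≤s⁻¹ i≤k)) (ε , ε∈ j , ε∈ l)
      ... | ‵fromℕ     | ‵inject₁ l = ⊥-elim (ℕ.<⇒≱ (Fin.toℕ<n l)
        (subst₂ ℕ._≤_ (Fin.toℕ-fromℕ (3 ℕ.+ r)) (toℕ-inject₁ l) (ℕ.s≤s⁻¹ i≤k)))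

    baseFlag : Flag cosetStructure
    baseFlag = record { face = baseFace ; rank-face = rank-baseFace ; mono = mono-baseFace }

module Mix {r : ℕ} {ℓ : Level}
  (P : Polytope (3 ℕ.+ r) ℓ) (Φ : Flag (Polytope.structure P)) (hP : ChiralOrDirectlyRegular P Φ)
  (Q : Polytope (3 ℕ.+ r) ℓ) (Ψ : Flag (Polytope.structure Q)) (hQ : ChiralOrDirectlyRegular Q Ψ)
  where

  Γ⁺P×Γ⁺Q : Group ℓ ℓ
  Γ⁺P×Γ⁺Q = DirectProduct.group (Γ⁺ P Φ hP) (Γ⁺ Q Ψ hQ)

  β : Fin (2 ℕ.+ r) → Group.Carrier Γ⁺P×Γ⁺Q
  β k = σ P Φ hP k , σ Q Ψ hQ k

  mixGroup : Group ℓ ℓ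
  mixGroup = generatedGroup Γ⁺P×Γ⁺Q β

  mixGenerators : Fin (2 ℕ.+ r) → Group.Carrier mixGroup
  mixGenerators k = β k , gen k

  open CosetGeometry mixGroup mixGenerators public
    using () renaming (cosetStructure to P◇Q; baseFlag to P◇Q-baseFlag)

{-# OPTIONS --safe #-}
module Submission where

-- A rotation never maps the base flag to an adjacent flag, so a rotation of a
-- polyhedron which fixes two of the three proper faces of the base flag is
-- trivial. Hence the stabilizers Stab i and Stab j of Γ⁺ meet trivially for
-- i ≢ j, and since the projections map stabilizers of the mix to stabilizers,
-- the same holds in the mix. In the coset geometry of such a group the flags are
-- (H₀ x , H₁ x , H₂ x) and (H₀ x , H₁ x , H₂ σ₂ x): two regular orbits under right
-- translation, interchanged by every adjacency. Factoring the generators of G_I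
-- into moves with index in I gives strong flag-connectedness. If some automorphism
-- joins the two orbits, the geometry is directly regular, the translations forming
-- its rotation group; otherwise it is chiral.

open import Defs
open import Algebra.Bundles using (Group)
open import Algebra.Morphism.Structures using (IsGroupHomomorphism)
import Algebra.Properties.Group as GroupProperties
open import Axiom.ExcludedMiddle using (ExcludedMiddle)
open import Data.Empty using (⊥-elim)
open import Data.Fin.Base as Fin using (Fin; zero; suc; toℕ; fromℕ; inject₁)
open import Data.Fin.Induction using (<-weakInduction)
open import Data.Fin.Properties using (_≟_; all?; toℕ-inject₁; toℕ-injective; toℕ<n; 0≢1+n)
open import Data.Fin.Relation.Unary.Top using (view; ‵fromℕ; ‵inject₁)
open import Data.List.Base using (List; []; _∷_; allFin)
open import Data.List.Membership.Propositional using (_∈_)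
open import Data.List.Membership.Propositional.Properties using (∈-allFin)
open import Data.List.Relation.Unary.Any using (here; there)
open import Data.Nat.Base as ℕ using (ℕ; zero; suc)
import Data.Nat.Properties as ℕ
open import Data.Product.Base using (Σ-syntax; ∃-syntax; _×_; _,_; proj₁; proj₂)
open import Data.Sum.Base using (_⊎_; inj₁; inj₂; [_,_]′)
open import Data.Unit.Base using (tt)
open import Function.Base using (_∘_)
open import Function.Bundles using (Equivalence; _⇔_; mk⇔)
open import Level using (Level; _⊔_; 0ℓ)
open import Relation.Binary.Construct.Closure.ReflexiveTransitive as Star 
  using (Star; _◅_; _◅◅_; reverse) renaming (ε to nil)
open import Relation.Binary.PropositionalEquality.Core as ≡ using (_≡_; _≢_; refl; cong; subst; subst₂)
open import Relation.Binary.Structures using (IsPartialOrder)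
open import Relation.Nullary.Decidable using (from-yes; ¬?; _→-dec_; _⊎-dec_)
open import Relation.Nullary.Decidable.Core using (yes; no)
open import Relation.Nullary.Negation.Core using (¬_)
open import Relation.Unary using (Pred; _⊆_; U)

-- Flags and automorphisms of polytopes

-- Rank 3 enters through the shape of the stabilizers: with `a`, `b` the two generators and
-- `t = a ∙ b`, those of ranks 0, 1, 2 are generated by the single elements `b`, `t`, `a`, and any
-- two of them meet trivially. Triviality, unlike an equality with a larger intersection group,
-- passes at once from the two factors to a subgroup of their product. The facts collected in
-- `IsPolyhedralRotation`, together with generation, then determine the geometry. As `t` is an
-- involution, an edge coset is a pair `x`, `t ∙ x`; transitivity of incidence, the list of flags
-- and the diamonds all come from case distinctions on such pairs. Excluded middle decides which
-- faces two flags share, which ranks occur in a chain and whether the two orbits are joined.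

toℕ-below<at : ∀ {n} (j : Fin n) → toℕ (below j) ℕ.< toℕ (at j)
toℕ-below<at j = ℕ.s≤s (ℕ.≤-reflexive (toℕ-inject₁ (inject₁ j)))

toℕ-at<above : ∀ {n} (j : Fin n) → toℕ (at j) ℕ.< toℕ (above j)
toℕ-at<above j = ℕ.s≤s (ℕ.s≤s (ℕ.≤-reflexive (toℕ-inject₁ j)))

toℕ<⇒≢ : ∀ {n} {i j : Fin n} → toℕ i ℕ.< toℕ j → i ≢ j
toℕ<⇒≢ i<j refl = ℕ.<-irrefl refl i<j

at-injective : ∀ {n} {i j : Fin n} → at i ≡ at j → i ≡ j
at-injective {i = i} {j} e = toℕ-injective
  (ℕ.suc-injective (≡.trans (≡.sym (cong suc (toℕ-inject₁ i))) (≡.trans (cong toℕ e) (cong suc (toℕ-inject₁ j)))))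

module _ {n : ℕ} {ℓ : Level} (S : RankedStructure n ℓ) where
  open RankedStructure S
  open Flag

  -- The index is a proper rank because all flags have the same least and greatest face
  -- (`adjacent⇒adjacentAt`).
  record AdjacentAt (j : Fin n) (X Y : Flag S) : Set ℓ where
    constructor adjacentAt
    field
      differs : ¬ (face X (at j) ≈ face Y (at j))
      agrees  : ∀ i → i ≢ at j → face X i ≈ face Y i

open AdjacentAt public

module PolytopeProperties {n : ℕ} {ℓ : Level} (em : ExcludedMiddle ℓ) (P : Polytope n ℓ) where
  open Polytope P
  open Flag
  open Automorphism

  private
    S = structure
    module Γ = Group (Γ P)

  infix 4 _≋_
  _≋_ : Flag S → Flag S → Set ℓ
  _≋_ = _≈ᶠ_ S

  adjacentAt-sym : ∀ {j X Y} → AdjacentAt S j X Y → AdjacentAt S j Y X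
  adjacentAt-sym (adjacentAt d s) = adjacentAt (λ e → d (Eq.sym e)) λ i i≢ → Eq.sym (s i i≢)

  adjacentAt-resp : ∀ {j X X′ Y Y′} → X ≋ X′ → Y ≋ Y′ → AdjacentAt S j X Y → AdjacentAt S j X′ Y′
  adjacentAt-resp p q (adjacentAt d s) = adjacentAt
    (λ e → d (Eq.trans (p _) (Eq.trans e (Eq.sym (q _)))))
    (λ i i≢ → Eq.trans (Eq.sym (p i)) (Eq.trans (s i i≢) (q i)))

  ^-adjacentAt : ∀ X j → AdjacentAt S j X (_^_ P X j)
  ^-adjacentAt X j = adjacentAt (^-differs P X j) (^-agrees P X j)

  ≤∧rank≡⇒≈ : ∀ {F G} → F ≤ G → rank F ≡ rank G → F ≈ G
  ≤∧rank≡⇒≈ {F} {G} F≤G e with em {F ≈ G}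
  ... | yes p = p
  ... | no ¬p = ⊥-elim (ℕ.<-irrefl (cong toℕ e) (rank-strict (F≤G , ¬p)))

  comparable∧rank≡⇒≈ : ∀ {F G} → F ≤ G ⊎ G ≤ F → rank F ≡ rank G → F ≈ G
  comparable∧rank≡⇒≈ (inj₁ F≤G) e = ≤∧rank≡⇒≈ F≤G e
  comparable∧rank≡⇒≈ (inj₂ G≤F) e = Eq.sym (≤∧rank≡⇒≈ G≤F (≡.sym e))

  face-zero-≈ : ∀ (X Y : Flag S) → face X zero ≈ face Y zero
  face-zero-≈ X Y = Eq.trans (Eq.sym (is-least X)) (is-least Y)
    where
    is-least : ∀ (Z : Flag S) → proj₁ least ≈ face Z zero
    is-least Z = ≤∧rank≡⇒≈ (proj₂ (proj₂ least) _)
      (≡.trans (proj₁ (proj₂ least)) (≡.sym (rank-face Z zero)))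

  face-top-≈ : ∀ (X Y : Flag S) → face X (fromℕ (suc n)) ≈ face Y (fromℕ (suc n))
  face-top-≈ X Y = Eq.trans (is-greatest X) (Eq.sym (is-greatest Y))
    where
    is-greatest : ∀ (Z : Flag S) → face Z (fromℕ (suc n)) ≈ proj₁ greatest
    is-greatest Z = ≤∧rank≡⇒≈ (proj₂ (proj₂ greatest) _)
      (≡.trans (rank-face Z _) (≡.sym (proj₁ (proj₂ greatest))))

  ≋-from-proper : ∀ {X Y : Flag S} → (∀ j → face X (at j) ≈ face Y (at j)) → X ≋ Y
  ≋-from-proper {X} {Y} p zero    = face-zero-≈ X Y
  ≋-from-proper {X} {Y} p (suc i) with view i
  ... | ‵fromℕ     = face-top-≈ X Y
  ... | ‵inject₁ j = p j

  adjacentAt-from-proper : ∀ {X Y : Flag S} j → ¬ (face X (at j) ≈ face Y (at j)) →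
    (∀ i → i ≢ j → face X (at i) ≈ face Y (at i)) → AdjacentAt S j X Y
  adjacentAt-from-proper {X} {Y} j d s = adjacentAt d agree
    where
    agree : ∀ i → i ≢ at j → face X i ≈ face Y i
    agree zero    _  = face-zero-≈ X Y
    agree (suc i) i≢ with view i
    ... | ‵fromℕ     = face-top-≈ X Y
    ... | ‵inject₁ k = s k (λ k≡j → i≢ (cong at k≡j))

  adjacent⇒adjacentAt : ∀ {X Y} → Adjacent S X Y → ∃[ j ] AdjacentAt S j X Y
  adjacent⇒adjacentAt {X} {Y} (zero , d , _) = ⊥-elim (d (face-zero-≈ X Y))
  adjacent⇒adjacentAt {X} {Y} (suc i , d , s) with view i
  ... | ‵fromℕ     = ⊥-elim (d (face-top-≈ X Y))
  ... | ‵inject₁ j = j , adjacentAt d s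

  adjacentAt⇒adjacent : ∀ {j X Y} → AdjacentAt S j X Y → Adjacent S X Y
  adjacentAt⇒adjacent {j} (adjacentAt d s) = at j , d , s

  face-< : ∀ (X : Flag S) {i k} → toℕ i ℕ.< toℕ k → face X i < face X k
  face-< X {i} {k} i<k = mono X (ℕ.<⇒≤ i<k) ,
    λ e → toℕ<⇒≢ i<k (≡.trans (≡.sym (rank-face X i)) (≡.trans (rank-cong e) (rank-face X k)))

  <-resp-≈ : ∀ {F F′ G G′} → F ≈ F′ → G ≈ G′ → F < G → F′ < G′
  <-resp-≈ p q (F≤G , F≉G) =
    ≤-trans (≤-reflexive (Eq.sym p)) (≤-trans F≤G (≤-reflexive q)) ,
    λ e → F≉G (Eq.trans p (Eq.trans e (Eq.sym q)))

  face-between : ∀ (X : Flag S) j {F G} → face X (below j) ≈ F → face X (above j) ≈ G →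
    Between j F G (face X (at j))
  face-between X j p q = rank-face X (at j)
    , <-resp-≈ p Eq.refl (face-< X (toℕ-below<at j))
    , <-resp-≈ Eq.refl q (face-< X (toℕ-at<above j))

  -- Only two faces are available, so replacing a face twice by a different one leads back to it.
  -- This yields both the uniqueness of adjacent flags and `τ²≈ε`.
  between-unique : ∀ (X : Flag S) j {A B C} → let I = Between j (face X (below j)) (face X (above j)) in
    I A → I B → I C → ¬ (A ≈ B) → ¬ (B ≈ C) → A ≈ C
  between-unique X j {A} {B} {C} a b c A≉B B≉C =
    go (only A a) (only B b) (only C c)
    where
    two = diamond j (rank-face X (below j)) (rank-face X (above j))
            (face-< X (ℕ.<-trans (toℕ-below<at j) (toℕ-at<above j)))
    only = proj₂ (proj₂ (proj₂ (proj₂ (proj₂ two))))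
    both : ∀ {D E F} → D ≈ F → E ≈ F → D ≈ E
    both p q = Eq.trans p (Eq.sym q)
    go : _ → _ → _ → A ≈ C
    go (inj₁ p) _        (inj₁ r) = both p r
    go (inj₂ p) _        (inj₂ r) = both p r
    go (inj₁ p) (inj₁ q) (inj₂ r) = ⊥-elim (A≉B (both p q))
    go (inj₁ p) (inj₂ q) (inj₂ r) = ⊥-elim (B≉C (both q r))
    go (inj₂ p) (inj₁ q) (inj₁ r) = ⊥-elim (B≉C (both q r))
    go (inj₂ p) (inj₂ q) (inj₁ r) = ⊥-elim (A≉B (both p q))

  -- Off rank `j` both flags agree with `X`; at rank `j` both differ from `X` inside the same
  -- diamond.
  adjacentAt-unique : ∀ {j X X′ Y Z} → X ≋ X′ → AdjacentAt S j X Y → AdjacentAt S j X′ Z → Y ≋ Z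
  adjacentAt-unique {j} {X} {X′} {Y} {Z} X≋X′ (adjacentAt dY sY) X′Z = ≋-from-proper {Y} {Z} go
    where
    XZ : AdjacentAt S j X Z
    XZ = adjacentAt-resp (λ i → Eq.sym (X≋X′ i)) (λ _ → Eq.refl) X′Z
    dZ = differs XZ
    sZ = agrees XZ
    below≢ = toℕ<⇒≢ (toℕ-below<at j)
    above≢ : above j ≢ at j
    above≢ e = toℕ<⇒≢ (toℕ-at<above j) (≡.sym e)
    go : ∀ k → face Y (at k) ≈ face Z (at k)
    go k with k ≟ j
    ... | yes refl = between-unique X j
      (face-between Y j (Eq.sym (sY _ below≢)) (Eq.sym (sY _ above≢)))
      (face-between X j Eq.refl Eq.refl)
      (face-between Z j (Eq.sym (sZ _ below≢)) (Eq.sym (sZ _ above≢)))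
      (λ e → dY (Eq.sym e)) dZ
    ... | no k≢j = Eq.trans (Eq.sym (sY _ at≢)) (sZ _ at≢)
      where
      at≢ : at k ≢ at j
      at≢ e = k≢j (at-injective e)

  Comparable : Face → Face → Set ℓ
  Comparable F G = F ≤ G ⊎ G ≤ F

  -- Going through the ranks, add a face of each rank whenever one fits.
  saturate : (is : List (Fin (2 ℕ.+ n))) (C : Pred Face ℓ) → IsChain S C →
    Σ[ D ∈ Pred Face ℓ ] IsChain S D × C ⊆ D ×
      (∀ G → rank G ∈ is → (∀ H → D H → Comparable G H) → D G)
  saturate []       C chain = C , chain , (λ c → c) , λ _ ()
  saturate (i ∷ is) C chain
    with em {∃[ G ] rank G ≡ i × (∀ H → C H → Comparable G H)}
  ... | yes (G , rG , fits) with saturate is C∪G chain′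
    where
    C∪G : Pred Face ℓ
    C∪G H = C H ⊎ H ≈ G
    chain′ : IsChain S C∪G
    chain′ F H (inj₁ c) (inj₁ d) = chain F H c d
    chain′ F H (inj₁ c) (inj₂ q) =
      [ (λ le → inj₂ (≤-trans (≤-reflexive q) le)) , (λ le → inj₁ (≤-trans le (≤-reflexive (Eq.sym q)))) ]′ (fits F c)
    chain′ F H (inj₂ p) (inj₁ d) =
      [ (λ le → inj₁ (≤-trans (≤-reflexive p) le)) , (λ le → inj₂ (≤-trans le (≤-reflexive (Eq.sym p)))) ]′ (fits H d)
    chain′ F H (inj₂ p) (inj₂ q) = inj₁ (≤-reflexive (Eq.trans p (Eq.sym q)))
  ...   | D , chainD , C∪G⊆D , saturated = D , chainD , (λ c → C∪G⊆D (inj₁ c)) , saturated′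
    where
    saturated′ : ∀ H → rank H ∈ (i ∷ is) → (∀ K → D K → Comparable H K) → D H
    saturated′ H (here rH) fitsH = C∪G⊆D (inj₂
      (comparable∧rank≡⇒≈ (fitsH G (C∪G⊆D (inj₂ Eq.refl))) (≡.trans rH (≡.sym rG))))
    saturated′ H (there r) fitsH = saturated H r fitsH
  saturate (i ∷ is) C chain | no none with saturate is C chain
  ... | D , chainD , C⊆D , saturated = D , chainD , C⊆D , saturated′
    where
    saturated′ : ∀ H → rank H ∈ (i ∷ is) → (∀ K → D K → Comparable H K) → D H
    saturated′ H (here rH) fitsH = ⊥-elim (none (H , rH , λ K c → fitsH K (C⊆D c)))
    saturated′ H (there r) fitsH = saturated H r fitsH

  -- The axiom `flags` concerns maximal chains only, so the chain of faces `≈ F` is first saturated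
  -- over all ranks.
  face∈flag : ∀ F → ∃[ X ] _∈ᶠ_ S F X
  face∈flag F with saturate (allFin _) (_≈ F) (λ G H p q → inj₁ (≤-reflexive (Eq.trans p (Eq.sym q))))
  ... | D , chain , F⊆D , saturated with flags D (record
          { isChain = chain
          ; maximal = λ E chainE D⊆E {G} e →
              saturated G (∈-allFin _) (λ H d → chainE G H e (D⊆E d)) })
  ...   | X , D⇔X = X , Equivalence.to (D⇔X F) (F⊆D Eq.refl)

  -- Along a flag through `F` the automorphism preserves strict inequalities, so the ranks of the
  -- images rise at every step. The same bound for the inverse gives equality.
  rank-≤ : ∀ (γ : Automorphism S) F → rank F Fin.≤ rank (to γ F)
  rank-≤ γ F with face∈flag F
  ... | X , i , p = subst₂ ℕ._≤_
          (cong toℕ (≡.trans (≡.sym (rank-face X i)) (rank-cong (Eq.sym p))))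
          (cong toℕ (rank-cong (to-cong γ (Eq.sym p))))
          (climb i)
    where
    climb : ∀ i → i Fin.≤ rank (to γ (face X i))
    climb = <-weakInduction _ ℕ.z≤n λ i ih → ℕ.≤-<-trans
      (subst (ℕ._≤ toℕ (rank (to γ (face X (inject₁ i))))) (toℕ-inject₁ i) ih)
      (rank-strict (let (le , ne) = face-< X {inject₁ i} {suc i} (ℕ.s≤s (ℕ.≤-reflexive (toℕ-inject₁ i)))
                    in to-mono γ le , λ e → ne (injective γ e)))

  rank-preserved : ∀ (γ : Automorphism S) F → rank (to γ F) ≡ rank F
  rank-preserved γ F = toℕ-injective (ℕ.≤-antisym
    (subst (λ r → toℕ (rank (to γ F)) ℕ.≤ toℕ r) (rank-cong (Γ.inverseʳ γ F)) (rank-≤ (γ Γ.⁻¹) (to γ F)))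
    (rank-≤ γ F))

  image : Automorphism S → Flag S → Flag S
  image γ X = record
    { face      = λ i → to γ (face X i)
    ; rank-face = λ i → ≡.trans (rank-preserved γ _) (rank-face X i)
    ; mono      = λ i≤k → to-mono γ (mono X i≤k)
    }

  image-adjacentAt : ∀ γ {j X Y} → AdjacentAt S j X Y → AdjacentAt S j (image γ X) (image γ Y)
  image-adjacentAt γ (adjacentAt d s) = adjacentAt (λ e → d (injective γ e)) (λ i i≢ → to-cong γ (s i i≢))

  connected-induction : ∀ {q} (Q : Flag S → Set q) → (∀ {X Y} → X ≋ Y → Q X → Q Y) →
    (∀ {j X Y} → AdjacentAt S j X Y → Q X → Q Y) → ∀ X Y → Q X → Q Y
  connected-induction Q ≋-closed adjacent-closed X Y q
    with stronglyFlagConnected X Y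
  ... | Y′ , path , Y′≋Y = ≋-closed Y′≋Y (along path q)
    where
    along : ∀ {Z} → Star (λ X′ Y′ → Adjacent S X′ Y′ × Contains-∩ S X Y Y′) Z Y′ → Q Z → Q Y′
    along nil                q = q
    along ((adj , _) ◅ rest) q = along rest (adjacent-closed (proj₂ (adjacent⇒adjacentAt adj)) q)

  -- Agreement on one flag spreads over an adjacency, since both images of the next flag are
  -- adjacent at the same rank to the same flag. Every face lies on a flag reached in this way.
  rigid : ∀ {γ δ : Automorphism S} X → image γ X ≋ image δ X → γ Γ.≈ δ
  rigid {γ} {δ} X p F with face∈flag F
  ... | Y , i , F≈ = Eq.trans (to-cong γ F≈) (Eq.trans (agree i) (to-cong δ (Eq.sym F≈)))
    where
    agree : image γ Y ≋ image δ Y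
    agree = connected-induction (λ Z → image γ Z ≋ image δ Z)
      (λ Z≋W q i → Eq.trans (to-cong γ (Eq.sym (Z≋W i))) (Eq.trans (q i) (to-cong δ (Z≋W i))))
      (λ a q → adjacentAt-unique q (image-adjacentAt γ a) (image-adjacentAt δ a))
      X Y p

  sameOrbit-sym : ∀ {X Y} → SameOrbit S X Y → SameOrbit S Y X
  sameOrbit-sym {X} (γ , p) = γ Γ.⁻¹ ,
    λ i → Eq.trans (to-cong (γ Γ.⁻¹) (Eq.sym (p i))) (Γ.inverseʳ γ (face X i))

  sameOrbit-trans : ∀ {X Y Z} → SameOrbit S X Y → SameOrbit S Y Z → SameOrbit S X Z
  sameOrbit-trans (γ , p) (δ , q) = γ Γ.∙ δ , λ i → Eq.trans (to-cong δ (p i)) (q i)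

-- Rotation groups of polyhedra and their mix

module Rotations {m : ℕ} {ℓ : Level} (em : ExcludedMiddle ℓ)
  (P : Polytope (suc m) ℓ) (Φ : Flag (Polytope.structure P)) where
  open Polytope P
  open Flag
  open Automorphism
  open PolytopeProperties em P

  private
    S = structure
    module Γ = Group (Γ P)

  -- The relation Φσ = (Φ^i)^(i-1) for i = k + 1, split at the intermediate flag so that chiral and
  -- regular generators can be handled alike.
  RotatesBase : Fin m → Automorphism S → Set ℓ
  RotatesBase k γ = ∃[ Y ] AdjacentAt structure (suc k) Φ Y × AdjacentAt structure (inject₁ k) Y (image γ Φ)

  -- Automorphisms act on the right, so the second factor of σ carries the pair Φ, Φ^k, adjacent at
  -- rank k, to the pair Φ^(k+1), Φσ.
  σ-regular-rotates : ∀ reg k → RotatesBase k (σ-regular P Φ reg k)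
  σ-regular-rotates reg k = _ , ^-adjacentAt Φ (suc k) ,
    adjacentAt-resp (proj₂ (reg Φ (_^_ P Φ (suc k)))) (λ _ → Eq.refl)
      (image-adjacentAt (ρ P Φ reg (suc k))
        (adjacentAt-resp {X′ = Φ} {Y′ = image (ρ P Φ reg (inject₁ k)) Φ} (λ _ → Eq.refl)
          (λ i → Eq.sym (proj₂ (reg Φ (_^_ P Φ (inject₁ k))) i))
          (^-adjacentAt Φ (inject₁ k))))

  σ-chiral-rotates : ∀ ch k → RotatesBase k (σ-chiral P Φ ch k)
  σ-chiral-rotates ch k = _ , ^-adjacentAt Φ (suc k) ,
    adjacentAt-resp (λ _ → Eq.refl) (λ i → Eq.sym (proj₂ (chiral-rotation P Φ ch k) i))
      (^-adjacentAt (_^_ P Φ (suc k)) (inject₁ k))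

  -- A reflection ρ_j in Γ⁺ would put all ρ_i, hence all of Γ, into Γ⁺.
  directlyRegular-no-reflection : (dr : DirectlyRegular P Φ) →
    let open DirectlyRegular dr in
    ∀ {γ j} → Generated (Γ P) (σ-regular P Φ regular) γ → ¬ AdjacentAt structure j Φ (image γ Φ)
  directlyRegular-no-reflection dr {γ} {j} γ∈ adj =
    -- If Γ⁺ is all of Γ, representatives of two distinct cosets lie in the same coset.
    0≢1+n (proj₂ (proj₂ index-2) zero (suc zero) (all∈ _))
    where
    open DirectlyRegular dr
    open GroupProperties (Γ P) using (\\-leftDividesʳ; //-rightDividesʳ)
    ρ′ = ρ P Φ regular
    Γ⁺′ = Generated (Γ P) (σ-regular P Φ regular)

    maps : ∀ i → image (ρ′ i) Φ ≋ _^_ P Φ i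
    maps i = proj₂ (regular Φ (_^_ P Φ i))

    ρj∈ : Γ⁺′ (ρ′ j)
    ρj∈ = resp (rigid {γ} {ρ′ j} Φ (λ i → Eq.trans
      (adjacentAt-unique (λ _ → Eq.refl) adj (^-adjacentAt Φ j) i) (Eq.sym (maps j i)))) γ∈

    ρ₀∈ : Γ⁺′ (ρ′ zero)
    -- A descent from `j` to 0 by ρ_k = σ ρ_(k+1)⁻¹, put into the motive because the induction runs
    -- upwards; `ρ∈` then climbs by ρ_(k+1) = ρ_k⁻¹ σ.
    ρ₀∈ = <-weakInduction (λ i → Γ⁺′ (ρ′ i) → Γ⁺′ (ρ′ zero)) (λ r → r)
      (λ k ih r → ih (resp (//-rightDividesʳ (ρ′ (suc k)) (ρ′ (inject₁ k))) (mul (gen k) (inv r)))) j ρj∈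

    ρ∈ : ∀ i → Γ⁺′ (ρ′ i)
    ρ∈ = <-weakInduction (λ i → Γ⁺′ (ρ′ i)) ρ₀∈
      (λ k r → resp (\\-leftDividesʳ (ρ′ (inject₁ k)) (ρ′ (suc k))) (mul (inv r) (gen k)))

    reaches : ∀ X → ∃[ δ ] Γ⁺′ δ × image δ Φ ≋ X
    reaches X = connected-induction (λ X → ∃[ δ ] Γ⁺′ δ × image δ Φ ≋ X)
      (λ X≋Y (δ , δ∈ , p) → δ , δ∈ , λ i → Eq.trans (p i) (X≋Y i))
      -- The reflection multiplies on the left: it takes Φ to Φ^i, whose image under `δ` is
      -- `i`-adjacent to the flag already reached.
      (λ {i} XY (δ , δ∈ , p) → ρ′ i Γ.∙ δ , mul (ρ∈ i) δ∈ , λ k → Eq.trans (to-cong δ (maps i k))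
        (adjacentAt-unique p (image-adjacentAt δ (^-adjacentAt Φ i)) XY k))
      Φ X (Γ.ε , unit , λ _ → Eq.refl)

    all∈ : ∀ δ → Γ⁺′ δ
    all∈ δ with reaches (image δ Φ)
    ... | δ′ , δ′∈ , p = resp (rigid {δ′} {δ} Φ p) δ′∈

  act : (h : ChiralOrDirectlyRegular P Φ) → Group.Carrier (Γ⁺ P Φ h) → Automorphism S
  act (inj₁ ch) γ = γ
  act (inj₂ dr) γ = proj₁ γ

  act-isHomomorphism : ∀ h → IsGroupHomomorphism (Group.rawGroup (Γ⁺ P Φ h)) (Group.rawGroup (Γ P)) (act h)
  act-isHomomorphism (inj₁ ch) = record
    { isMonoidHomomorphism = record
      { isMagmaHomomorphism = record
        { isRelHomomorphism = record { cong = λ p → p } ; homo = λ _ _ _ → Eq.refl }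
      ; ε-homo = λ _ → Eq.refl }
    ; ⁻¹-homo = λ _ _ → Eq.refl }
  act-isHomomorphism (inj₂ dr) = record
    { isMonoidHomomorphism = record
      { isMagmaHomomorphism = record
        { isRelHomomorphism = record { cong = λ p → p } ; homo = λ _ _ _ → Eq.refl }
      ; ε-homo = λ _ → Eq.refl }
    ; ⁻¹-homo = λ _ _ → Eq.refl }

  act-injective : ∀ h {g g′} → act h g Γ.≈ act h g′ → Group._≈_ (Γ⁺ P Φ h) g g′
  act-injective (inj₁ ch) p = p
  act-injective (inj₂ dr) p = p

  σ-rotates : ∀ h k → RotatesBase k (act h (σ P Φ h k))
  σ-rotates (inj₁ ch) k = σ-chiral-rotates ch k
  σ-rotates (inj₂ dr) k = σ-regular-rotates (DirectlyRegular.regular dr) k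

  no-reflection : ∀ h {j} g → ¬ AdjacentAt structure j Φ (image (act h g) Φ)
  no-reflection (inj₁ ch) γ adj =
    Chiral.adjacent-differ ch Φ (image γ Φ) (adjacentAt⇒adjacent adj) (γ , λ _ → Eq.refl)
  no-reflection (inj₂ dr) (γ , γ∈) adj = directlyRegular-no-reflection dr γ∈ adj

-- Face stabilizers in the rotation group of a polyhedron

module _ {ℓ : Level} (G : Group ℓ ℓ) (s : Fin 2 → Group.Carrier G) where
  open Group G
  open CosetGeometry G {0} s using (Stab)

  -- The input of the coset geometry. The two inequations keep apart the two faces of each diamond;
  -- with `τ²≈ε` the edge stabilizer has order two.
  record IsPolyhedralRotation : Set ℓ where
    field
      τ²≈ε   : τ G s zero (suc zero) ∙ τ G s zero (suc zero) ≈ ε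
      s₂≉ε   : ¬ (s (suc zero) ≈ ε)
      τ≉ε    : ¬ (τ G s zero (suc zero) ≈ ε)
      Stab-∩ : ∀ {i j g} → i ≢ j → Stab i g → Stab j g → g ≈ ε

fourth-equals : ∀ (i j k l : Fin 3) → i ≢ j → k ≢ i → k ≢ j → l ≢ k → l ≡ i ⊎ l ≡ j
fourth-equals = from-yes (all? {3} λ i → all? {3} λ j → all? {3} λ k → all? {3} λ l →
  ¬? (i ≟ j) →-dec ¬? (k ≟ i) →-dec ¬? (k ≟ j) →-dec ¬? (l ≟ k) →-dec (l ≟ i ⊎-dec l ≟ j))

module _ {ℓ : Level} (em : ExcludedMiddle ℓ) (P : Polyhedron ℓ)
  (Φ : Flag (Polytope.structure P)) (h : ChiralOrDirectlyRegular P Φ) where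
  open Polytope P
  open Flag
  open Automorphism
  open PolytopeProperties em P
  open Rotations em P Φ

  private
    module Γ = Group (Γ P)
    module Γ⁺ = Group (Γ⁺ P Φ h)
    open IsGroupHomomorphism (act-isHomomorphism h)
    s = σ P Φ h
    t = τ (Γ⁺ P Φ h) s zero (suc zero)
    open CosetGeometry (Γ⁺ P Φ h) {0} s using (Stab)

    F : Fin 3 → Face
    F j = face Φ (at j)

    infixl 5 _·_
    _·_ : Face → Γ⁺.Carrier → Face
    G · g = to (act h g) G

    ·-∙ : ∀ g g′ G → G · (g Γ⁺.∙ g′) ≈ G · g · g′
    ·-∙ g g′ G = homo g g′ G

    fixes-two⇒≈ε : ∀ {i j} → i ≢ j → ∀ g → F i · g ≈ F i → F j · g ≈ F j → g Γ⁺.≈ Γ⁺.ε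
    fixes-two⇒≈ε {i} {j} i≢j g fix-i fix-j = act-injective h
      (Γ.trans {act h g} {Γ.ε} {act h Γ⁺.ε}
        (rigid {act h g} {Γ.ε} Φ (≋-from-proper {image (act h g) Φ} {Φ} fix))
        (Γ.sym {act h Γ⁺.ε} {Γ.ε} ε-homo))
      where
      fix : ∀ k → F k · g ≈ F k
      fix k with k ≟ i | k ≟ j | em {F k · g ≈ F k}
      ... | yes refl | _        | _     = fix-i
      ... | no _     | yes refl | _     = fix-j
      ... | no _     | no _     | yes p = p
      ... | no k≢i   | no k≢j   | no ¬p = ⊥-elim (no-reflection h g
        (adjacentAt-from-proper {Φ} {image (act h g) Φ} k (λ e → ¬p (Eq.sym e)) λ l l≢k →
          [ (λ { refl → Eq.sym fix-i }) , (λ { refl → Eq.sym fix-j }) ]′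
            (fourth-equals i j k l i≢j k≢i k≢j l≢k)))

    σ₁-rotates = σ-rotates h zero
    σ₂-rotates = σ-rotates h (suc zero)
    Y₁ = proj₁ σ₁-rotates
    Y₂ = proj₁ σ₂-rotates

    -- Applying σ₂ to Φ, Φ¹, Φ¹⁰ = Φσ₁ gives Φσ₂ = Φ²¹, Φ², Φ²⁰ = Φτ.
    t-rotates : AdjacentAt structure zero Y₂ (image (act h t) Φ)
    t-rotates = adjacentAt-resp
      (adjacentAt-unique (λ _ → Eq.refl)
        (image-adjacentAt (act h (s (suc zero))) (proj₁ (proj₂ σ₁-rotates)))
        (adjacentAt-sym (proj₂ (proj₂ σ₂-rotates))))
      (λ i → Eq.sym (·-∙ (s zero) (s (suc zero)) (face Φ i)))
      (image-adjacentAt (act h (s (suc zero))) (proj₂ (proj₂ σ₁-rotates)))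

    -- Each rotation is a change at two ranks: 1 and 0 for σ₁, 2 and 1 for σ₂, 2 and 0 for `t`. The
    -- face of the remaining rank stays.
    σ₁-fixes : F (suc (suc zero)) ≈ F (suc (suc zero)) · s zero
    σ₁-fixes = Eq.trans (agrees (proj₁ (proj₂ σ₁-rotates)) _ λ ())
      (agrees (proj₂ (proj₂ σ₁-rotates)) _ λ ())

    σ₂-fixes : F zero ≈ F zero · s (suc zero)
    σ₂-fixes = Eq.trans (agrees (proj₁ (proj₂ σ₂-rotates)) _ λ ())
      (agrees (proj₂ (proj₂ σ₂-rotates)) _ λ ())

    t-fixes : F (suc zero) ≈ F (suc zero) · t
    t-fixes = Eq.trans (agrees (proj₁ (proj₂ σ₂-rotates)) _ λ ()) (agrees t-rotates _ λ ())

    t-moves : ¬ (F zero ≈ F zero · t)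
    t-moves e = differs t-rotates
      (Eq.trans (Eq.sym (agrees (proj₁ (proj₂ σ₂-rotates)) _ λ ())) e)

    σ₂-moves : ¬ (F (suc (suc zero)) ≈ F (suc (suc zero)) · s (suc zero))
    σ₂-moves e = differs (proj₁ (proj₂ σ₂-rotates))
      (Eq.trans e (Eq.sym (agrees (proj₂ (proj₂ σ₂-rotates)) _ λ ())))

    moves⇒≉ε : ∀ {g} j → ¬ (F j ≈ F j · g) → ¬ (g Γ⁺.≈ Γ⁺.ε)
    moves⇒≉ε {g} j m g≈ε = m (Eq.sym (Eq.trans (⟦⟧-cong g≈ε (F j)) (ε-homo (F j))))

    -- Each stabilizer has one generator: σ₂, `t`, σ₁ for `j` = 0, 1, 2. Every other index pair
    -- would involve the excluded rank `j`.
    Stab-fixes : ∀ {j g} → Stab j g → F j · g ≈ F j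
    Stab-fixes {zero} (gen (suc zero , suc zero , _)) = Eq.sym σ₂-fixes
    Stab-fixes {zero} (gen (zero , _ , _ , 0≢0 , _)) = ⊥-elim (0≢0 refl)
    Stab-fixes {suc zero} (gen (zero , suc zero , _)) = Eq.sym t-fixes
    Stab-fixes {suc zero} (gen (zero , zero , _ , _ , 1≢1)) = ⊥-elim (1≢1 refl)
    Stab-fixes {suc zero} (gen (suc zero , _ , _ , 1≢1 , _)) = ⊥-elim (1≢1 refl)
    Stab-fixes {suc (suc zero)} (gen (zero , zero , _)) = Eq.sym σ₁-fixes
    Stab-fixes {suc (suc zero)} (gen (_ , suc zero , _ , _ , 2≢2)) = ⊥-elim (2≢2 refl)
    Stab-fixes unit = ε-homo _
    Stab-fixes (mul {x} {y} p q) = Eq.trans (·-∙ x y _)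
      (Eq.trans (to-cong (act h y) (Stab-fixes p)) (Stab-fixes q))
    Stab-fixes (inv {x} p) = Eq.trans (⁻¹-homo x _) (injective (act h x)
      (Eq.trans (Γ.inverseˡ (act h x) _) (Eq.sym (Stab-fixes p))))
    Stab-fixes (resp e p) = Eq.trans (Eq.sym (⟦⟧-cong e _)) (Stab-fixes p)

    -- `t` fixes the base edge and moves its base vertex; the edge has only two vertices, so `t`
    -- swaps them.
    t²-fixes : F zero · (t Γ⁺.∙ t) ≈ F zero
    t²-fixes = Eq.trans (·-∙ t t _) (Eq.sym (between-unique Φ zero
      (face-between Φ zero Eq.refl Eq.refl)
      (face-between (image (act h t) Φ) zero (face-zero-≈ (image (act h t) Φ) Φ) (Eq.sym t-fixes))
      (face-between (image (act h t) (image (act h t) Φ)) zero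
        (face-zero-≈ (image (act h t) (image (act h t) Φ)) Φ)
        (Eq.trans (to-cong (act h t) (Eq.sym t-fixes)) (Eq.sym t-fixes)))
      t-moves (λ e → t-moves (injective (act h t) e))))

  Γ⁺-isPolyhedralRotation : IsPolyhedralRotation (Γ⁺ P Φ h) (σ P Φ h)
  Γ⁺-isPolyhedralRotation = record
    { τ²≈ε   = fixes-two⇒≈ε {zero} {suc zero} (λ ()) _ t²-fixes
                 (Eq.trans (·-∙ t t _)
                   (Eq.trans (to-cong (act h t) (Eq.sym t-fixes)) (Eq.sym t-fixes)))
    ; s₂≉ε   = moves⇒≉ε _ σ₂-moves
    ; τ≉ε    = moves⇒≉ε _ t-moves
    ; Stab-∩ = λ i≢j p q → fixes-two⇒≈ε i≢j _ (Stab-fixes p) (Stab-fixes q)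
    }

-- Homomorphisms and the rotation group of the mix

module _ {ℓ : Level} {G H : Group ℓ ℓ} {f : Group.Carrier G → Group.Carrier H}
  (hom : IsGroupHomomorphism (Group.rawGroup G) (Group.rawGroup H) f) where
  private
    module G = Group G
    module H = Group H
  open IsGroupHomomorphism hom

  product-upTo-homo : ∀ {m} (s : Fin m → G.Carrier) k →
    f (product-upTo G s k) H.≈ product-upTo H (f ∘ s) k
  product-upTo-homo s zero    = H.refl
  product-upTo-homo s (suc k) = H.trans (homo _ _) (H.∙-congˡ (product-upTo-homo (s ∘ suc) k))

  τ-homo : ∀ {m} (s : Fin m → G.Carrier) i k → f (τ G s i k) H.≈ τ H (f ∘ s) i k
  τ-homo s zero    k       = product-upTo-homo s k
  τ-homo s (suc i) zero    = ε-homo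
  τ-homo s (suc i) (suc k) = τ-homo (s ∘ suc) i k

  Subgroup-homo : ∀ {m} (s : Fin m → G.Carrier) I {x} → Subgroup G s I x → Subgroup H (f ∘ s) I (f x)
  Subgroup-homo s I (gen (i , k , p)) = resp (H.sym (τ-homo s i k)) (gen (i , k , p))
  Subgroup-homo s I unit              = resp (H.sym ε-homo) unit
  Subgroup-homo s I (mul p q)         = resp (H.sym (homo _ _)) (mul (Subgroup-homo s I p) (Subgroup-homo s I q))
  Subgroup-homo s I (inv p)           = resp (H.sym (⁻¹-homo _)) (inv (Subgroup-homo s I p))
  Subgroup-homo s I (resp e p)        = resp (⟦⟧-cong e) (Subgroup-homo s I p)

-- The second component of an element is a word for it, and this word can be read again inside the
-- generated group.
generatedGroup-generated : ∀ {ℓ} (G : Group ℓ ℓ) {I : Set} (g : I → Group.Carrier G) →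
  ∀ {x} (p : Generated G g x) → Generated (generatedGroup G g) (λ i → g i , gen i) (x , p)
generatedGroup-generated G g (gen i)    = gen i
generatedGroup-generated G g unit       = unit
generatedGroup-generated G g (mul p q)  =
  mul (generatedGroup-generated G g p) (generatedGroup-generated G g q)
generatedGroup-generated G g (inv p)    = inv (generatedGroup-generated G g p)
generatedGroup-generated G g (resp e p) = resp e (generatedGroup-generated G g p)

module _ {ℓ : Level} (em : ExcludedMiddle ℓ)
  (P : Polyhedron ℓ) (Φ : Flag (Polytope.structure P)) (hP : ChiralOrDirectlyRegular P Φ)
  (Q : Polyhedron ℓ) (Ψ : Flag (Polytope.structure Q)) (hQ : ChiralOrDirectlyRegular Q Ψ) where
  open Mix P Φ hP Q Ψ hQ

  mix-isPolyhedralRotation : IsPolyhedralRotation mixGroup mixGenerators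
  mix-isPolyhedralRotation = record
    { τ²≈ε   = RP.τ²≈ε , RQ.τ²≈ε
    -- An equation in the mix holds in both components, so refuting it in one is enough.
    ; s₂≉ε   = λ e → RP.s₂≉ε (proj₁ e)
    ; τ≉ε    = λ e → RP.τ≉ε (proj₁ e)
    ; Stab-∩ = λ {i} {j} i≢j p q →
        RP.Stab-∩ i≢j (Subgroup-homo projP mixGenerators (_≢ i) p) (Subgroup-homo projP mixGenerators (_≢ j) q) ,
        RQ.Stab-∩ i≢j (Subgroup-homo projQ mixGenerators (_≢ i) p) (Subgroup-homo projQ mixGenerators (_≢ j) q)
    }
    where
    module RP = IsPolyhedralRotation (Γ⁺-isPolyhedralRotation em P Φ hP)
    module RQ = IsPolyhedralRotation (Γ⁺-isPolyhedralRotation em Q Ψ hQ)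
    module GP = Group (Γ⁺ P Φ hP)
    module GQ = Group (Γ⁺ Q Ψ hQ)

    projP : IsGroupHomomorphism (Group.rawGroup mixGroup) GP.rawGroup (λ x → proj₁ (proj₁ x))
    projP = record
      { isMonoidHomomorphism = record
        { isMagmaHomomorphism = record
          { isRelHomomorphism = record { cong = proj₁ } ; homo = λ _ _ → GP.refl }
        ; ε-homo = GP.refl }
      ; ⁻¹-homo = λ _ → GP.refl }

    projQ : IsGroupHomomorphism (Group.rawGroup mixGroup) GQ.rawGroup (λ x → proj₂ (proj₁ x))
    projQ = record
      { isMonoidHomomorphism = record
        { isMagmaHomomorphism = record
          { isRelHomomorphism = record { cong = proj₂ } ; homo = λ _ _ → GQ.refl }
        ; ε-homo = GQ.refl }
      ; ⁻¹-homo = λ _ → GQ.refl }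

-- The coset geometry of a polyhedral rotation group

increasing-triple : ∀ {i j k : Fin 3} → i Fin.< j → j Fin.< k →
  i ≡ zero × j ≡ suc zero × k ≡ suc (suc zero)
increasing-triple {zero}  {suc zero}       {suc (suc zero)} _ _             = refl , refl , refl
increasing-triple {suc _} {suc zero}                        (ℕ.s≤s ())
increasing-triple {_}     {suc zero}       {suc zero}       _ (ℕ.s≤s ())
increasing-triple {_}     {suc (suc zero)} {suc zero}       _ (ℕ.s≤s ())
increasing-triple {_}     {suc (suc zero)} {suc (suc zero)} _ (ℕ.s≤s (ℕ.s≤s ()))

module PolyhedralCosetGeometry {ℓ : Level} (em : ExcludedMiddle ℓ) (G : Group ℓ ℓ)
  (s : Fin 2 → Group.Carrier G) (rotation : IsPolyhedralRotation G s)
  (generated : ∀ g → Generated G s g) where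
  open Group G renaming (ε to e; refl to ≈-refl; sym to ≈-sym; trans to ≈-trans)
  open GroupProperties G
  open IsPolyhedralRotation rotation
  open CosetGeometry G {0} s
  open import Relation.Binary.Reasoning.Setoid setoid

  pattern 𝟘 = zero
  pattern 𝟙 = suc zero
  pattern 𝟚 = suc (suc zero)

  -- Calculations with right cosets of the stabilizers

  a b t : Carrier
  a = s 𝟘
  b = s 𝟙
  t = a ∙ b

  infix 4 _~[_]_
  _~[_]_ : Carrier → Fin 3 → Carrier → Set ℓ
  x ~[ j ] y = Stab j (x ∙ y ⁻¹)

  module _ {j : Fin 3} where
    ≈⇒~ : ∀ {x y} → x ≈ y → x ~[ j ] y
    ≈⇒~ x≈y = resp (≈-sym (x≈y⇒x∙y⁻¹≈ε x≈y)) unit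

    ~-refl : ∀ {x} → x ~[ j ] x
    ~-refl = ≈⇒~ ≈-refl

    ~-sym : ∀ {x y} → x ~[ j ] y → y ~[ j ] x
    ~-sym p = resp (⁻¹-anti-homo-// _ _) (inv p)

    ~-trans : ∀ {x y z} → x ~[ j ] y → y ~[ j ] z → x ~[ j ] z
    ~-trans {x} {y} {z} p q = resp (begin
      x ∙ y ⁻¹ ∙ (y ∙ z ⁻¹)  ≈⟨ assoc _ _ _ ⟨
      x ∙ y ⁻¹ ∙ y ∙ z ⁻¹    ≈⟨ ∙-congʳ (//-rightDividesˡ y x) ⟩
      x ∙ z ⁻¹               ∎) (mul p q)

    ~-∙ʳ : ∀ {x y} g → x ~[ j ] y → x ∙ g ~[ j ] y ∙ g
    ~-∙ʳ {x} {y} g p = resp (≈-sym (begin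
      x ∙ g ∙ (y ∙ g) ⁻¹     ≈⟨ ∙-congˡ (⁻¹-anti-homo-∙ y g) ⟩
      x ∙ g ∙ (g ⁻¹ ∙ y ⁻¹)  ≈⟨ assoc _ _ _ ⟨
      x ∙ g ∙ g ⁻¹ ∙ y ⁻¹    ≈⟨ ∙-congʳ (//-rightDividesʳ g x) ⟩
      x ∙ y ⁻¹               ∎)) p

    absorb : ∀ {h} x → Stab j h → h ∙ x ~[ j ] x
    absorb x h∈ = resp (≈-sym (//-rightDividesʳ x _)) h∈

  -- The form in which the trivial intersections are used: an element is determined by its cosets of
  -- two different types.
  ~-separates : ∀ {i j x y} → i ≢ j → x ~[ i ] y → x ~[ j ] y → x ≈ y
  ~-separates i≢j p q = x∙y⁻¹≈ε⇒x≈y _ _ (Stab-∩ i≢j p q)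

  a∈ : Stab 𝟚 a
  a∈ = gen (𝟘 , 𝟘 , ℕ.z≤n , (λ ()) , (λ ()))

  b∈ : Stab 𝟘 b
  b∈ = gen (𝟙 , 𝟙 , ℕ.s≤s ℕ.z≤n , (λ ()) , (λ ()))

  t∈ : Stab 𝟙 t
  t∈ = gen (𝟘 , 𝟙 , ℕ.z≤n , (λ ()) , (λ ()))

  -- As `t = a ∙ b` with `a` in H₂, left multiplication by `t` and by `b` lead to the same face
  -- coset.
  t~b : ∀ x → t ∙ x ~[ 𝟚 ] b ∙ x
  t~b x = ~-trans (≈⇒~ (assoc a b x)) (absorb (b ∙ x) a∈)

  t⁻¹≈t : t ⁻¹ ≈ t
  t⁻¹≈t = ≈-sym (inverseˡ-unique t t τ²≈ε)

  t∙t∙ : ∀ x → t ∙ (t ∙ x) ≈ x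
  t∙t∙ x = ≈-trans (≈-sym (assoc t t x)) (≈-trans (∙-congʳ τ²≈ε) (identityˡ x))

  t∙b⁻¹ : ∀ x → t ∙ (b ⁻¹ ∙ x) ≈ a ∙ x
  t∙b⁻¹ x = ≈-trans (≈-sym (assoc t (b ⁻¹) x)) (∙-congʳ (//-rightDividesʳ b a))

  b∙b⁻¹ : ∀ x → b ∙ (b ⁻¹ ∙ x) ≈ x
  b∙b⁻¹ = \\-leftDividesˡ b

  b⁻¹∙b : ∀ x → b ⁻¹ ∙ (b ∙ x) ≈ x
  b⁻¹∙b = \\-leftDividesʳ b

  b⁻¹~ : ∀ x → b ⁻¹ ∙ x ~[ 𝟘 ] x
  b⁻¹~ x = absorb x (inv b∈)

  b∙t~ : ∀ x → b ∙ (t ∙ x) ~[ 𝟚 ] x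
  b∙t~ x = ~-trans (~-sym (t~b (t ∙ x))) (≈⇒~ (t∙t∙ x))

  -- `t ∙ x` always lies in H₁ x; lying in a second coset of `x` as well would force `t ≈ e`. The
  -- lemma for `b` uses H₀ x in the same way.
  t≁ : ∀ j → j ≢ 𝟙 → ∀ x → ¬ (x ~[ j ] t ∙ x)
  t≁ j j≢1 x p = τ≉ε (identityˡ-unique t x (~-separates j≢1 (~-sym p) (absorb x t∈)))

  b≁ : ∀ j → j ≢ 𝟘 → ∀ x → ¬ (x ~[ j ] b ∙ x)
  b≁ j j≢0 x p = s₂≉ε (identityˡ-unique b x (~-separates j≢0 (~-sym p) (absorb x b∈)))

  b⁻¹≁ : ∀ x → ¬ (x ~[ 𝟙 ] b ⁻¹ ∙ x)
  b⁻¹≁ x p = b≁ 𝟙 (λ ()) (b ⁻¹ ∙ x) (~-sym (~-trans (≈⇒~ (b∙b⁻¹ x)) p))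

  -- H₁ is generated by the involution `t`, so every word collapses to one of two elements.
  Stab₁-elements : ∀ {h} → Stab 𝟙 h → h ≈ e ⊎ h ≈ t
  Stab₁-elements (gen (𝟘 , 𝟙 , _))                = inj₂ ≈-refl
  Stab₁-elements (gen (𝟘 , 𝟘 , _ , _ , 1≢1))      = ⊥-elim (1≢1 refl)
  Stab₁-elements (gen (𝟙 , _ , _ , 1≢1 , _))      = ⊥-elim (1≢1 refl)
  Stab₁-elements unit                             = inj₁ ≈-refl
  Stab₁-elements (mul p q) with Stab₁-elements p | Stab₁-elements q
  ... | inj₁ x | inj₁ y = inj₁ (≈-trans (∙-cong x y) (identityˡ e))
  ... | inj₁ x | inj₂ y = inj₂ (≈-trans (∙-cong x y) (identityˡ t))
  ... | inj₂ x | inj₁ y = inj₂ (≈-trans (∙-cong x y) (identityʳ t))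
  ... | inj₂ x | inj₂ y = inj₁ (≈-trans (∙-cong x y) τ²≈ε)
  Stab₁-elements (inv p) with Stab₁-elements p
  ... | inj₁ x = inj₁ (≈-trans (⁻¹-cong x) ε⁻¹≈ε)
  ... | inj₂ x = inj₂ (≈-trans (⁻¹-cong x) t⁻¹≈t)
  Stab₁-elements (resp p q) with Stab₁-elements q
  ... | inj₁ x = inj₁ (≈-trans (≈-sym p) x)
  ... | inj₂ x = inj₂ (≈-trans (≈-sym p) x)

  ~₁-elements : ∀ {x y} → y ~[ 𝟙 ] x → y ≈ x ⊎ y ≈ t ∙ x
  ~₁-elements {x} {y} p with Stab₁-elements p
  ... | inj₁ q = inj₁ (x∙y⁻¹≈ε⇒x≈y y x q)
  ... | inj₂ q = inj₂ (≈-trans (≈-sym (//-rightDividesˡ x y)) (∙-congʳ q))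

  Meets : Fin 3 → Carrier → Fin 3 → Carrier → Set ℓ
  Meets i g j h = ∃[ x ] x ~[ i ] g × x ~[ j ] h

  meets-same : ∀ {j g h} → Meets j g j h → g ~[ j ] h
  meets-same (x , p , q) = ~-trans (~-sym p) q

  meets-sym : ∀ {i g j h} → Meets i g j h → Meets j h i g
  meets-sym (x , p , q) = x , q , p

  meets-resp : ∀ {i g g′ j h h′} → g ~[ i ] g′ → h ~[ j ] h′ → Meets i g j h → Meets i g′ j h′
  meets-resp p q (x , r , u) = x , ~-trans r p , ~-trans u q

  -- If the edge coset H₁ h = {x , t x} meets H₀ g in x and H₂ k in t x, then b x ∈ H₀ g ∩ H₂ k.
  meets-trans₀₁₂ : ∀ {g h k} → Meets 𝟘 g 𝟙 h → Meets 𝟙 h 𝟚 k → Meets 𝟘 g 𝟚 k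
  meets-trans₀₁₂ (x , x~g , x~h) (y , y~h , y~k) with ~₁-elements (~-trans y~h (~-sym x~h))
  ... | inj₁ y≈x  = x , x~g , ~-trans (≈⇒~ (≈-sym y≈x)) y~k
  ... | inj₂ y≈tx = b ∙ x , ~-trans (absorb x b∈) x~g ,
          ~-trans (~-sym (t~b x)) (~-trans (≈⇒~ (≈-sym y≈tx)) y~k)

  meets-trans : ∀ {i j k g h l} → i Fin.≤ j → j Fin.≤ k → Meets i g j h → Meets j h k l → Meets i g k l
  meets-trans {i} {j} {k} i≤j j≤k p q with i ≟ j | j ≟ k
  ... | yes refl | _        = meets-resp (~-sym (meets-same p)) ~-refl q
  ... | no _     | yes refl = meets-resp ~-refl (meets-same q) p
  ... | no i≢j   | no j≢k
    with refl , refl , refl ← increasing-triple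
           (ℕ.≤∧≢⇒< i≤j (λ eq → i≢j (toℕ-injective eq)))
           (ℕ.≤∧≢⇒< j≤k (λ eq → j≢k (toℕ-injective eq))) = meets-trans₀₁₂ p q

  -- The partial order and the rank function

  ≈ᶜ-refl : ∀ {F} → F ≈ᶜ F
  ≈ᶜ-refl {bottom}    = bottom≈
  ≈ᶜ-refl {top}       = top≈
  ≈ᶜ-refl {coset j g} = coset≈ ~-refl

  ≈ᶜ-sym : ∀ {F H} → F ≈ᶜ H → H ≈ᶜ F
  ≈ᶜ-sym bottom≈    = bottom≈
  ≈ᶜ-sym top≈       = top≈
  ≈ᶜ-sym (coset≈ p) = coset≈ (~-sym p)

  ≈ᶜ-trans : ∀ {F H K} → F ≈ᶜ H → H ≈ᶜ K → F ≈ᶜ K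
  ≈ᶜ-trans bottom≈    bottom≈    = bottom≈
  ≈ᶜ-trans top≈       top≈       = top≈
  ≈ᶜ-trans (coset≈ p) (coset≈ q) = coset≈ (~-trans p q)

  ≤ᶜ-reflexive : ∀ {F H} → F ≈ᶜ H → F ≤ᶜ H
  ≤ᶜ-reflexive bottom≈    = bottom≤
  ≤ᶜ-reflexive top≈       = ≤top
  ≤ᶜ-reflexive (coset≈ p) = coset≤ ℕ.≤-refl (_ , ~-refl , p)

  ≤ᶜ-trans : ∀ {F H K} → F ≤ᶜ H → H ≤ᶜ K → F ≤ᶜ K
  ≤ᶜ-trans bottom≤        _              = bottom≤
  ≤ᶜ-trans ≤top           ≤top           = ≤top
  ≤ᶜ-trans (coset≤ _ _)   ≤top           = ≤top
  ≤ᶜ-trans (coset≤ i≤j p) (coset≤ j≤k q) = coset≤ (ℕ.≤-trans i≤j j≤k) (meets-trans i≤j j≤k p q)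

  ≤ᶜ-antisym : ∀ {F H} → F ≤ᶜ H → H ≤ᶜ F → F ≈ᶜ H
  ≤ᶜ-antisym bottom≤        bottom≤        = bottom≈
  ≤ᶜ-antisym ≤top           ≤top           = top≈
  ≤ᶜ-antisym (coset≤ i≤j p) (coset≤ j≤i _) with toℕ-injective (ℕ.≤-antisym i≤j j≤i)
  ... | refl = coset≈ (meets-same p)

  ≤ᶜ-isPartialOrder : IsPartialOrder _≈ᶜ_ _≤ᶜ_
  ≤ᶜ-isPartialOrder = record
    { isPreorder = record
      { isEquivalence = record { refl = ≈ᶜ-refl ; sym = ≈ᶜ-sym ; trans = ≈ᶜ-trans }
      ; reflexive     = ≤ᶜ-reflexive
      ; trans         = ≤ᶜ-trans
      }
    ; antisym = ≤ᶜ-antisym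
    }

  rankᶜ-cong : ∀ {F H} → F ≈ᶜ H → rankᶜ F ≡ rankᶜ H
  rankᶜ-cong bottom≈    = refl
  rankᶜ-cong top≈       = refl
  rankᶜ-cong (coset≈ _) = refl

  rankᶜ-strict : ∀ {F H} → F ≤ᶜ H × ¬ (F ≈ᶜ H) → rankᶜ F Fin.< rankᶜ H
  rankᶜ-strict {H = bottom}    (bottom≤ , ≉) = ⊥-elim (≉ bottom≈)
  rankᶜ-strict {H = top}       (bottom≤ , ≉) = ℕ.s≤s ℕ.z≤n
  rankᶜ-strict {H = coset _ _} (bottom≤ , ≉) = ℕ.s≤s ℕ.z≤n
  rankᶜ-strict {bottom}        (≤top , ≉)    = ℕ.s≤s ℕ.z≤n
  rankᶜ-strict {top}           (≤top , ≉)    = ⊥-elim (≉ top≈)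
  rankᶜ-strict {coset j _}     (≤top , ≉)    =
    ℕ.s≤s (subst (ℕ._< 3) (≡.sym (toℕ-inject₁ j)) (toℕ<n j))
  rankᶜ-strict {coset i _} {coset j _} (coset≤ i≤j p , ≉) with i ≟ j
  ... | yes refl = ⊥-elim (≉ (coset≈ (meets-same p)))
  ... | no i≢j   = ℕ.s≤s (subst₂ ℕ._<_ (≡.sym (toℕ-inject₁ i)) (≡.sym (toℕ-inject₁ j))
          (ℕ.≤∧≢⇒< i≤j (λ eq → i≢j (toℕ-injective eq))))

  -- Even and odd flags and their adjacencies

  open Flag

  Flagᶜ : Set ℓ
  Flagᶜ = Flag cosetStructure

  infix 4 _≋_
  _≋_ : Flagᶜ → Flagᶜ → Set ℓ
  _≋_ = _≈ᶠ_ cosetStructure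

  triangle : (f : Fin 3 → Carrier) → (∀ {i j} → i Fin.≤ j → Meets i (f i) j (f j)) → Flagᶜ
  triangle f meet = record { face = φ ; rank-face = rank-φ ; mono = λ {i} {k} → mono-φ i k }
    where
    φ : Fin 5 → CosetFace
    φ 𝟘                         = bottom
    φ 𝟙                         = coset 𝟘 (f 𝟘)
    φ 𝟚                         = coset 𝟙 (f 𝟙)
    φ (suc (suc (suc 𝟘)))       = coset 𝟚 (f 𝟚)
    φ (suc (suc (suc (suc 𝟘)))) = top
    rank-φ : ∀ i → rankᶜ (φ i) ≡ i
    rank-φ 𝟘                         = refl
    rank-φ 𝟙                         = refl
    rank-φ 𝟚                         = refl
    rank-φ (suc (suc (suc 𝟘)))       = refl
    rank-φ (suc (suc (suc (suc 𝟘)))) = refl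
    below-φ : ∀ i j → toℕ i ℕ.≤ toℕ (at j) → φ i ≤ᶜ coset j (f j)
    below-φ 𝟘                         j _ = bottom≤
    below-φ 𝟙                         j _ = coset≤ ℕ.z≤n (meet ℕ.z≤n)
    below-φ 𝟚                         𝟘 (ℕ.s≤s ())
    below-φ 𝟚                         (suc j) _ = coset≤ (ℕ.s≤s ℕ.z≤n) (meet (ℕ.s≤s ℕ.z≤n))
    below-φ (suc (suc (suc 𝟘)))       𝟘 (ℕ.s≤s ())
    below-φ (suc (suc (suc 𝟘)))       𝟙 (ℕ.s≤s (ℕ.s≤s ()))
    below-φ (suc (suc (suc 𝟘)))       𝟚 _ = coset≤ ℕ.≤-refl (meet ℕ.≤-refl)
    below-φ (suc (suc (suc (suc 𝟘)))) 𝟘 (ℕ.s≤s ())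
    below-φ (suc (suc (suc (suc 𝟘)))) 𝟙 (ℕ.s≤s (ℕ.s≤s ()))
    below-φ (suc (suc (suc (suc 𝟘)))) 𝟚 (ℕ.s≤s (ℕ.s≤s (ℕ.s≤s ())))
    mono-φ : ∀ i k → i Fin.≤ k → φ i ≤ᶜ φ k
    mono-φ 𝟘 𝟘                         _ = bottom≤
    mono-φ i 𝟙                         p = below-φ i 𝟘 p
    mono-φ i 𝟚                         p = below-φ i 𝟙 p
    mono-φ i (suc (suc (suc 𝟘)))       p = below-φ i 𝟚 p
    mono-φ i (suc (suc (suc (suc 𝟘)))) _ = ≤top

  -- Up to ≋ every flag is (H₀ x , H₁ x , H₂ x) or (H₀ x , H₁ x , H₂ b x) for a unique x.

  even odd : Carrier → Flagᶜ
  even x = triangle (λ _ → x) (λ _ → x , ~-refl , ~-refl)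
  odd x = triangle f meet
    where
    f : Fin 3 → Carrier
    f 𝟘 = x
    f 𝟙 = x
    f 𝟚 = b ∙ x
    -- Unlike an even flag, an odd flag has no element common to its three cosets, so each pair
    -- needs its own witness.
    meet : ∀ {i j} → i Fin.≤ j → Meets i (f i) j (f j)
    meet {𝟘} {𝟘} _ = x , ~-refl , ~-refl
    meet {𝟘} {𝟙} _ = x , ~-refl , ~-refl
    meet {𝟘} {𝟚} _ = b ∙ x , absorb x b∈ , ~-refl
    meet {𝟙} {𝟘} ()
    meet {𝟙} {𝟙} _ = x , ~-refl , ~-refl
    meet {𝟙} {𝟚} _ = t ∙ x , absorb x t∈ , t~b x
    meet {𝟚} {𝟙} (ℕ.s≤s ())
    meet {𝟚} {𝟚} _ = b ∙ x , ~-refl , ~-refl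

  coset-of-rank : ∀ F j → rankᶜ F ≡ at j → ∃[ g ] F ≡ coset j g
  coset-of-rank (coset i g) j r with at-injective r
  ... | refl = g , refl
  coset-of-rank top 𝟘 ()
  coset-of-rank top 𝟙 ()
  coset-of-rank top 𝟚 ()

  rankᶜ≡0 : ∀ F → rankᶜ F ≡ zero → F ≡ bottom
  rankᶜ≡0 bottom _ = refl

  rankᶜ≡4 : ∀ F → rankᶜ F ≡ fromℕ 4 → F ≡ top
  rankᶜ≡4 top _ = refl
  rankᶜ≡4 (coset 𝟘 _) ()
  rankᶜ≡4 (coset 𝟙 _) ()
  rankᶜ≡4 (coset 𝟚 _) ()

  coset≤⁻¹ : ∀ {i j g h} → coset i g ≤ᶜ coset j h → Meets i g j h
  coset≤⁻¹ (coset≤ _ p) = p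

  coset≈⁻¹ : ∀ {j g h} → coset j g ≈ᶜ coset j h → g ~[ j ] h
  coset≈⁻¹ (coset≈ p) = p

  -- The hypothesis is tied to the given `i`, so it can be supplied at one rank while the flags
  -- differ at another, as in `adjacentAt-cosets`.
  faces-agree : ∀ (X Y : Flagᶜ) i → (∀ j → i ≡ at j → face X i ≈ᶜ face Y i) → face X i ≈ᶜ face Y i
  faces-agree X Y 𝟘 _ =
    subst₂ _≈ᶜ_ (≡.sym (rankᶜ≡0 _ (rank-face X 𝟘))) (≡.sym (rankᶜ≡0 _ (rank-face Y 𝟘))) bottom≈
  faces-agree X Y 𝟙 p = p 𝟘 refl
  faces-agree X Y 𝟚 p = p 𝟙 refl
  faces-agree X Y (suc (suc (suc 𝟘))) p = p 𝟚 refl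
  faces-agree X Y i@(suc (suc (suc (suc 𝟘)))) _ =
    subst₂ _≈ᶜ_ (≡.sym (rankᶜ≡4 _ (rank-face X i))) (≡.sym (rankᶜ≡4 _ (rank-face Y i))) top≈

  ≋-cosets : ∀ {X Y : Flagᶜ} → (∀ j → face X (at j) ≈ᶜ face Y (at j)) → X ≋ Y
  ≋-cosets {X} {Y} p i = faces-agree X Y i λ { j refl → p j }

  IsEven IsOdd : Flagᶜ → Set ℓ
  IsEven X = ∃[ x ] X ≋ even x
  IsOdd X = ∃[ x ] X ≋ odd x

  -- The vertex and edge share some `x`, the edge and face some `y`. Both lie in the edge coset, and
  -- `y ≈ x` or `y ≈ t ∙ x` decides the parity.
  even-or-odd : ∀ X → IsEven X ⊎ IsOdd X
  even-or-odd X
    with coset-of-rank _ 𝟘 (rank-face X 𝟙) | coset-of-rank _ 𝟙 (rank-face X 𝟚)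
       | coset-of-rank _ 𝟚 (rank-face X (suc 𝟚))
  ... | g , X₀ | h , X₁ | k , X₂
    with coset≤⁻¹ (subst₂ _≤ᶜ_ X₀ X₁ (mono X (ℕ.s≤s ℕ.z≤n)))
       | coset≤⁻¹ (subst₂ _≤ᶜ_ X₁ X₂ (mono X (ℕ.s≤s (ℕ.s≤s ℕ.z≤n))))
  ... | x , x~g , x~h | y , y~h , y~k with ~₁-elements (~-trans y~h (~-sym x~h))
  ... | inj₁ y≈x = inj₁ (x , ≋-cosets {X} {even x} λ
    { 𝟘 → subst (_≈ᶜ _) (≡.sym X₀) (coset≈ (~-sym x~g))
    ; 𝟙 → subst (_≈ᶜ _) (≡.sym X₁) (coset≈ (~-sym x~h))
    ; 𝟚 → subst (_≈ᶜ _) (≡.sym X₂) (coset≈ (~-trans (~-sym y~k) (≈⇒~ y≈x))) })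
  ... | inj₂ y≈tx = inj₂ (x , ≋-cosets {X} {odd x} λ
    { 𝟘 → subst (_≈ᶜ _) (≡.sym X₀) (coset≈ (~-sym x~g))
    ; 𝟙 → subst (_≈ᶜ _) (≡.sym X₁) (coset≈ (~-sym x~h))
    ; 𝟚 → subst (_≈ᶜ _) (≡.sym X₂)
            (coset≈ (~-trans (~-sym y~k) (~-trans (≈⇒~ y≈tx) (t~b x)))) })

  -- Ranks 0 and 1 identify the two elements; rank 2 would then put `y` and `b ∙ y` into one coset
  -- of H₂.
  even∧odd : ∀ {X} → IsEven X → IsOdd X → ∀ {q} {Q : Set q} → Q
  even∧odd (x , p) (y , q) = ⊥-elim (b≁ 𝟚 (λ ()) y
    (~-trans (≈⇒~ (≈-sym x≈y)) (~-at 𝟚 (suc 𝟚) (λ z → z))))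
    where
    -- The argument is always the identity: it typechecks because at a concrete rank both faces
    -- reduce to cosets.
    ~-at : ∀ j i {g h} → (face (even x) i ≈ᶜ face (odd y) i → coset j g ≈ᶜ coset j h) → g ~[ j ] h
    ~-at j i c = coset≈⁻¹ (c (≈ᶜ-trans (≈ᶜ-sym (p i)) (q i)))
    x≈y : x ≈ y
    x≈y = ~-separates {𝟘} {𝟙} (λ ()) (~-at 𝟘 𝟙 (λ z → z)) (~-at 𝟙 𝟚 (λ z → z))

  adjacentAt-cosets : ∀ {X Y : Flagᶜ} j → ¬ (face X (at j) ≈ᶜ face Y (at j)) →
    (∀ i → i ≢ j → face X (at i) ≈ᶜ face Y (at i)) → AdjacentAt cosetStructure j X Y
  adjacentAt-cosets {X} {Y} j d p = adjacentAt d
    λ i i≢ → faces-agree X Y i λ { k refl → p k (λ k≡j → i≢ (cong at k≡j)) }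

  even-cong : ∀ {x y} → x ≈ y → even x ≋ even y
  even-cong {x} {y} p = ≋-cosets {even x} {even y} λ
    { 𝟘 → coset≈ (≈⇒~ p) ; 𝟙 → coset≈ (≈⇒~ p) ; 𝟚 → coset≈ (≈⇒~ p) }

  -- Solutions `y` of the coset equations for `odd y` next to `even x`. Rank 2 keeps `x`. At rank 1,
  -- `y` must lie in H₀ x with H₂ (b y) = H₂ x, so `y` is `b ⁻¹ ∙ x`. At rank 0, `y` is the other
  -- element `t ∙ x` of H₁ x, and H₂ (b t x) = H₂ (t t x) = H₂ x.
  across across⁻¹ : Fin 3 → Carrier → Carrier
  across 𝟘 x = t ∙ x
  across 𝟙 x = b ⁻¹ ∙ x
  across 𝟚 x = x
  across⁻¹ 𝟘 x = t ∙ x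
  across⁻¹ 𝟙 x = b ∙ x
  across⁻¹ 𝟚 x = x

  even-across : ∀ j x → AdjacentAt cosetStructure j (even x) (odd (across j x))
  even-across 𝟘 x = adjacentAt-cosets 𝟘 (λ p → t≁ 𝟘 (λ ()) x (coset≈⁻¹ p)) λ
    { 𝟘 0≢0 → ⊥-elim (0≢0 refl)
    ; 𝟙 _ → coset≈ (~-sym (absorb x t∈))
    ; 𝟚 _ → coset≈ (~-sym (b∙t~ x)) }
  even-across 𝟙 x = adjacentAt-cosets 𝟙 (λ p → b⁻¹≁ x (coset≈⁻¹ p)) λ
    { 𝟘 _ → coset≈ (~-sym (b⁻¹~ x))
    ; 𝟙 1≢1 → ⊥-elim (1≢1 refl)
    ; 𝟚 _ → coset≈ (≈⇒~ (≈-sym (b∙b⁻¹ x))) }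
  even-across 𝟚 x = adjacentAt-cosets 𝟚 (λ p → b≁ 𝟚 (λ ()) x (coset≈⁻¹ p)) λ
    { 𝟘 _ → coset≈ ~-refl
    ; 𝟙 _ → coset≈ ~-refl
    ; 𝟚 2≢2 → ⊥-elim (2≢2 refl) }

  odd-across : ∀ j x → AdjacentAt cosetStructure j (odd x) (even (across⁻¹ j x))
  odd-across 𝟘 x = adjacentAt-cosets 𝟘 (λ p → t≁ 𝟘 (λ ()) x (coset≈⁻¹ p)) λ
    { 𝟘 0≢0 → ⊥-elim (0≢0 refl)
    ; 𝟙 _ → coset≈ (~-sym (absorb x t∈))
    ; 𝟚 _ → coset≈ (~-sym (t~b x)) }
  odd-across 𝟙 x = adjacentAt-cosets 𝟙 (λ p → b≁ 𝟙 (λ ()) x (coset≈⁻¹ p)) λ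
    { 𝟘 _ → coset≈ (~-sym (absorb x b∈))
    ; 𝟙 1≢1 → ⊥-elim (1≢1 refl)
    ; 𝟚 _ → coset≈ ~-refl }
  odd-across 𝟚 x = adjacentAt-cosets 𝟚 (λ p → b≁ 𝟚 (λ ()) x (coset≈⁻¹ (≈ᶜ-sym p))) λ
    { 𝟘 _ → coset≈ ~-refl
    ; 𝟙 _ → coset≈ ~-refl
    ; 𝟚 2≢2 → ⊥-elim (2≢2 refl) }

  -- Strong flag-connectedness

  Step : ∀ {i} → Pred (Fin 3) i → Flagᶜ → Flagᶜ → Set (i ⊔ ℓ)
  Step I X Y = (∃[ j ] I j × AdjacentAt cosetStructure j X Y) ⊎ X ≋ Y

  Path : ∀ {i} → Pred (Fin 3) i → Flagᶜ → Flagᶜ → Set (i ⊔ ℓ)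
  Path I = Star (Step I)

  module _ {i} {I : Pred (Fin 3) i} where
    via : ∀ j → I j → ∀ {X Y} → AdjacentAt cosetStructure j X Y → Step I X Y
    via j Ij adj = inj₁ (j , Ij , adj)

    by-≋ : ∀ {X Y} → X ≋ Y → Path I X Y
    by-≋ p = inj₂ p ◅ nil

    path-sym : ∀ {X Y} → Path I X Y → Path I Y X
    path-sym = reverse λ
      { (inj₁ (j , Ij , adjacentAt d p)) →
          inj₁ (j , Ij , adjacentAt (λ q → d (≈ᶜ-sym q)) (λ i i≢ → ≈ᶜ-sym (p i i≢)))
      ; (inj₂ p) → inj₂ (λ i → ≈ᶜ-sym (p i)) }

    path-fixes : ∀ {k} → ¬ I k → ∀ {X Y} → Path I X Y → face X (at k) ≈ᶜ face Y (at k)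
    path-fixes ¬Ik nil = ≈ᶜ-refl
    path-fixes ¬Ik (inj₁ (j , Ij , adj) ◅ path) = ≈ᶜ-trans
      (agrees adj _ (λ q → ¬Ik (subst I (≡.sym (at-injective q)) Ij))) (path-fixes ¬Ik path)
    path-fixes ¬Ik (inj₂ p ◅ path) = ≈ᶜ-trans (p _) (path-fixes ¬Ik path)

  path-⊆ : ∀ {i j} {I : Pred (Fin 3) i} {J : Pred (Fin 3) j} → (∀ {k} → I k → J k) →
    ∀ {X Y} → Path I X Y → Path J X Y
  path-⊆ I⊆J = Star.map λ
    { (inj₁ (k , Ik , adj)) → inj₁ (k , I⊆J Ik , adj) ; (inj₂ p) → inj₂ p }

  -- The generator τ_{i,k} of G_I is a k-move followed by an (i - 1)-move, and i - 1, k ∈ I.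
  subgroup-path : ∀ I {h} → Subgroup G s I h → ∀ x → Path I (even x) (even (h ∙ x))
  -- The generator is `a`, written as `t ∙ b ⁻¹`: the 1-move contributes `b ⁻¹`, the 0-move
  -- contributes `t`.
  subgroup-path I (gen (𝟘 , 𝟘 , _ , I₀ , I₁)) x =
    via 𝟙 I₁ (even-across 𝟙 x) ◅ via 𝟘 I₀ (odd-across 𝟘 (b ⁻¹ ∙ x)) ◅ by-≋ (even-cong (t∙b⁻¹ x))
  subgroup-path I (gen (𝟘 , 𝟙 , _ , I₀ , I₂)) x =
    via 𝟚 I₂ (even-across 𝟚 x) ◅ via 𝟘 I₀ (odd-across 𝟘 x) ◅ nil
  subgroup-path I (gen (𝟙 , 𝟙 , _ , I₁ , I₂)) x =
    via 𝟚 I₂ (even-across 𝟚 x) ◅ via 𝟙 I₁ (odd-across 𝟙 x) ◅ nil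
  subgroup-path I unit x = by-≋ (even-cong (≈-sym (identityˡ x)))
  subgroup-path I (mul {g} {h} p q) x = subgroup-path I q x ◅◅ subgroup-path I p (h ∙ x) ◅◅
    by-≋ (even-cong (≈-sym (assoc g h x)))
  subgroup-path I (inv {h} p) x = by-≋ (even-cong (≈-sym (\\-leftDividesˡ h x))) ◅◅
    path-sym (subgroup-path I p (h ⁻¹ ∙ x))
  subgroup-path I (resp q p) x = subgroup-path I p x ◅◅ by-≋ (even-cong (∙-congʳ q))

  generated⇒Subgroup-U : ∀ {g} → Generated G s g → Subgroup G s U g
  generated⇒Subgroup-U (gen 𝟘)    = gen (𝟘 , 𝟘 , ℕ.z≤n , tt , tt)
  generated⇒Subgroup-U (gen 𝟙)    = gen (𝟙 , 𝟙 , ℕ.s≤s ℕ.z≤n , tt , tt)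
  generated⇒Subgroup-U unit       = unit
  generated⇒Subgroup-U (mul p q)  = mul (generated⇒Subgroup-U p) (generated⇒Subgroup-U q)
  generated⇒Subgroup-U (inv p)    = inv (generated⇒Subgroup-U p)
  generated⇒Subgroup-U (resp q p) = resp q (generated⇒Subgroup-U p)

  module _ (X Y : Flagᶜ) where
    Shared Unshared : Pred (Fin 3) ℓ
    Shared j = face X (at j) ≈ᶜ face Y (at j)
    Unshared j = ¬ Shared j

    -- One move at an unshared rank turns an odd flag into an even one without touching a shared
    -- face.
    path-to-even : ∀ {l} → Unshared l → ∀ Z → ∃[ z ] Path Unshared Z (even z)
    path-to-even {l} ul Z with even-or-odd Z
    ... | inj₁ (z , p) = z , by-≋ p
    ... | inj₂ (z , p) = across⁻¹ l z , inj₂ p ◅ via l ul (odd-across l z) ◅ nil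

    -- Once both ends are even, every shared rank places `x` and `y` in one coset. It remains to
    -- write `y ∙ x ⁻¹` with generators whose moves are at unshared ranks.
    path-via-subgroup : ∀ {l} → Unshared l →
      (∀ {x y} → (∀ {k} → Shared k → y ~[ k ] x) →
        x ≈ y ⊎ Σ[ I ∈ Pred (Fin 3) 0ℓ ] Subgroup G s I (y ∙ x ⁻¹) × (∀ {k} → I k → Unshared k)) →
      Path Unshared X Y
    path-via-subgroup ul find
      with path-to-even ul X | path-to-even ul Y
    ... | x , X→x | y , Y→y = X→x ◅◅ middle ◅◅ path-sym Y→y
      where
      shared~ : ∀ {k} → Shared k → face (even y) (at k) ≈ᶜ face (even x) (at k)
      shared~ sk = ≈ᶜ-trans (≈ᶜ-sym (path-fixes (λ uk → uk sk) Y→y))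
        (≈ᶜ-trans (≈ᶜ-sym sk) (path-fixes (λ uk → uk sk) X→x))
      shared~′ : ∀ {k} → Shared k → y ~[ k ] x
      shared~′ {𝟘} sk = coset≈⁻¹ (shared~ sk)
      shared~′ {𝟙} sk = coset≈⁻¹ (shared~ sk)
      shared~′ {𝟚} sk = coset≈⁻¹ (shared~ sk)
      middle : Path Unshared (even x) (even y)
      middle with find shared~′
      ... | inj₁ x≈y             = by-≋ (even-cong x≈y)
      ... | inj₂ (I , h∈ , I⊆)   = path-⊆ I⊆ (subgroup-path I h∈ x) ◅◅
        by-≋ (even-cong (//-rightDividesˡ x y))

    path-two-shared : ∀ {i j l} → i ≢ j → Shared i → Shared j → Unshared l → Path Unshared X Y
    path-two-shared i≢j si sj ul = path-via-subgroup ul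
      λ y~x → inj₁ (≈-sym (~-separates i≢j (y~x si) (y~x sj)))

    path-one-shared : ∀ {k l} → Shared k → Unshared l → (∀ {j} → j ≢ k → Unshared j) → Path Unshared X Y
    path-one-shared {k} sk ul others = path-via-subgroup ul
      -- `Stab k` is by definition the subgroup G_I for the set I of ranks other than `k`, so the
      -- coset relation is itself the required membership.
      λ y~x → inj₂ ((_≢ k) , y~x sk , others)

    path-none-shared : (∀ j → Unshared j) → Path Unshared X Y
    path-none-shared none = path-via-subgroup (none 𝟘)
      λ _ → inj₂ (U , generated⇒Subgroup-U (generated _) , λ {k} _ → none k)

    unshared-path : Path Unshared X Y
    unshared-path with em {Shared 𝟘} | em {Shared 𝟙} | em {Shared 𝟚}
    ... | yes p | yes q | yes r = by-≋ (≋-cosets {X} {Y} λ { 𝟘 → p ; 𝟙 → q ; 𝟚 → r })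
    ... | yes p | yes q | no r  = path-two-shared {𝟘} {𝟙} (λ ()) p q r
    ... | yes p | no q  | yes r = path-two-shared {𝟘} {𝟚} (λ ()) p r q
    ... | no p  | yes q | yes r = path-two-shared {𝟙} {𝟚} (λ ()) q r p
    ... | yes p | no q  | no r  = path-one-shared p q
      λ { {𝟘} n → ⊥-elim (n refl) ; {𝟙} _ → q ; {𝟚} _ → r }
    ... | no p  | yes q | no r  = path-one-shared q p
      λ { {𝟘} _ → p ; {𝟙} n → ⊥-elim (n refl) ; {𝟚} _ → r }
    ... | no p  | no q  | yes r = path-one-shared r p
      λ { {𝟘} _ → p ; {𝟙} _ → q ; {𝟚} n → ⊥-elim (n refl) }
    ... | no p  | no q  | no r  = path-none-shared λ { 𝟘 → p ; 𝟙 → q ; 𝟚 → r }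

    KeepsShared : Flagᶜ → Set ℓ
    KeepsShared Z = ∀ {k} → Shared k → face X (at k) ≈ᶜ face Z (at k)

    -- A face on both `X` and `Y` has the same position in both, by its rank, and is therefore
    -- shared at that position.
    contains-∩ : ∀ {Z} → KeepsShared Z → Contains-∩ cosetStructure X Y Z
    contains-∩ {Z} keeps F (i , p) (k , q) with
      ≡.trans (≡.sym (rank-face X i)) (≡.trans (rankᶜ-cong (≈ᶜ-trans (≈ᶜ-sym p) q)) (rank-face Y k))
    ... | refl = i , ≈ᶜ-trans p (faces-agree X Z i λ { j refl → keeps (≈ᶜ-trans (≈ᶜ-sym p) q) })

    keepsShared-step : ∀ {j Z′ Z V} → Z′ ≋ Z → KeepsShared Z′ → Unshared j →
      AdjacentAt cosetStructure j Z V → KeepsShared V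
    keepsShared-step Z′≋Z keeps uj adj sk = ≈ᶜ-trans (keeps sk) (≈ᶜ-trans (Z′≋Z _)
      (agrees adj _ (λ q → uj (subst Shared (at-injective q) sk))))

    -- Steps along `≋` are not adjacencies. They are absorbed by letting the star lag behind at some
    -- `Z′ ≋ Z`, so its end is also only `≋ W`.
    path⇒star : ∀ {Z Z′ W} → Z′ ≋ Z → KeepsShared Z′ → Path Unshared Z W →
      ∃[ W′ ] Star (λ A B → Adjacent cosetStructure A B × Contains-∩ cosetStructure X Y B) Z′ W′ × W′ ≋ W
    path⇒star Z′≋Z keeps nil = _ , nil , Z′≋Z
    path⇒star Z′≋Z keeps (inj₂ p ◅ path) = path⇒star (λ i → ≈ᶜ-trans (Z′≋Z i) (p i)) keeps path
    path⇒star {Z} {Z′} Z′≋Z keeps (_◅_ {j = V} (inj₁ (j , uj , adj@(adjacentAt d p))) path)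
      with path⇒star {V} {V} (λ _ → ≈ᶜ-refl) (keepsShared-step {Z′ = Z′} Z′≋Z keeps uj adj) path
    ... | W′ , star , W′≋W = W′ ,
      ((at j , (λ q → d (≈ᶜ-trans (≈ᶜ-sym (Z′≋Z _)) q)) , λ i i≢ → ≈ᶜ-trans (Z′≋Z i) (p i i≢)) ,
        contains-∩ {V} (keepsShared-step {Z′ = Z′} Z′≋Z keeps uj adj)) ◅ star , W′≋W

    stronglyConnectedᶜ : StronglyConnected cosetStructure X Y
    stronglyConnectedᶜ = path⇒star {X} {X} (λ _ → ≈ᶜ-refl) (λ _ → ≈ᶜ-refl) unshared-path

  -- Maximal chains

  module _ (C : Pred CosetFace ℓ) (maximal : IsMaximalChain cosetStructure C) where
    open IsMaximalChain maximal using (isChain)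

    chain-meets : ∀ {i j g h} → C (coset i g) → C (coset j h) → Meets i g j h
    chain-meets p q with isChain _ _ p q
    ... | inj₁ (coset≤ _ m) = m
    ... | inj₂ (coset≤ _ m) = meets-sym m

    -- The faces of a flag form a chain, so maximality of `C` turns the inclusion into equality.
    contained⇒flag : (X : Flagᶜ) → (∀ F → C F → _∈ᶠ_ cosetStructure F X) →
      ∃[ X ] (∀ F → C F ⇔ _∈ᶠ_ cosetStructure F X)
    contained⇒flag X C⊆X = X , λ F → mk⇔ (C⊆X F) (λ F∈X → IsMaximalChain.maximal maximal
      (λ H → _∈ᶠ_ cosetStructure H X) X-chain (λ {H} c → C⊆X H c) F∈X)
      where
      X-chain : IsChain cosetStructure (λ H → _∈ᶠ_ cosetStructure H X)
      X-chain F H (i , p) (k , q) with ℕ.≤-total (toℕ i) (toℕ k)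
      ... | inj₁ i≤k = inj₁ (≤ᶜ-trans (≤ᶜ-reflexive p) (≤ᶜ-trans (mono X i≤k) (≤ᶜ-reflexive (≈ᶜ-sym q))))
      ... | inj₂ k≤i = inj₂ (≤ᶜ-trans (≤ᶜ-reflexive q) (≤ᶜ-trans (mono X k≤i) (≤ᶜ-reflexive (≈ᶜ-sym p))))

    triangle-contains : ∀ f (meet : ∀ {i j} → i Fin.≤ j → Meets i (f i) j (f j)) →
      (∀ {j g} → C (coset j g) → g ~[ j ] f j) → ∀ F → C F → _∈ᶠ_ cosetStructure F (triangle f meet)
    triangle-contains f meet c bottom      _ = 𝟘 , bottom≈
    triangle-contains f meet c top         _ = fromℕ 4 , top≈
    triangle-contains f meet c (coset 𝟘 g) p = 𝟙 , coset≈ (c p)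
    triangle-contains f meet c (coset 𝟙 g) p = 𝟚 , coset≈ (c p)
    triangle-contains f meet c (coset 𝟚 g) p = suc 𝟚 , coset≈ (c p)

    Occurs : Fin 3 → Set ℓ
    Occurs j = ∃[ g ] C (coset j g)

    -- A chain with at most two types of cosets has an element common to all of them, hence lies in
    -- an even flag.
    common-element : ∀ i j → (∀ k → Occurs k → k ≡ i ⊎ k ≡ j) →
      ∃[ x ] (∀ {k g} → C (coset k g) → g ~[ k ] x)
    common-element i j only with em {Occurs i} | em {Occurs j}
    -- No coset occurs, so the choice of element is arbitrary.
    ... | no ¬i | no ¬j = e , λ c →
      [ (λ { refl → ⊥-elim (¬i (_ , c)) }) , (λ { refl → ⊥-elim (¬j (_ , c)) }) ]′ (only _ (_ , c))
    ... | yes (g , p) | no ¬j = g , λ c →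
      [ (λ { refl → meets-same (chain-meets c p) }) , (λ { refl → ⊥-elim (¬j (_ , c)) }) ]′ (only _ (_ , c))
    ... | no ¬i | yes (h , q) = h , λ c →
      [ (λ { refl → ⊥-elim (¬i (_ , c)) }) , (λ { refl → meets-same (chain-meets c q) }) ]′ (only _ (_ , c))
    ... | yes (g , p) | yes (h , q) with chain-meets p q
    ...   | x , x~g , x~h = x , λ c →
      [ (λ { refl → ~-trans (meets-same (chain-meets c p)) (~-sym x~g) })
      , (λ { refl → ~-trans (meets-same (chain-meets c q)) (~-sym x~h) }) ]′ (only _ (_ , c))

    from-common : ∃[ x ] (∀ {k g} → C (coset k g) → g ~[ k ] x) →
      ∃[ X ] (∀ F → C F ⇔ _∈ᶠ_ cosetStructure F X)
    from-common (x , c) = contained⇒flag (even x) 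
      (triangle-contains (λ _ → x) (λ _ → x , ~-refl , ~-refl) c)

    flagsᶜ : ∃[ X ] (∀ F → C F ⇔ _∈ᶠ_ cosetStructure F X)
    flagsᶜ with em {Occurs 𝟘} | em {Occurs 𝟙} | em {Occurs 𝟚}
    -- Three types may lack a common element, as in an odd flag; the pairwise meetings still give a
    -- flag.
    ... | yes p | yes q | yes r =
      contained⇒flag (triangle f meet) (triangle-contains f meet (λ c → meets-same (chain-meets c (f∈ _))))
      where
      occurs : ∀ j → Occurs j
      occurs 𝟘 = p
      occurs 𝟙 = q
      occurs 𝟚 = r
      f : Fin 3 → Carrier
      f j = proj₁ (occurs j)
      f∈ : ∀ j → C (coset j (f j))
      f∈ j = proj₂ (occurs j)
      meet : ∀ {i j} → i Fin.≤ j → Meets i (f i) j (f j)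
      meet _ = chain-meets (f∈ _) (f∈ _)
    ... | no ¬p | _ | _ = from-common (common-element 𝟙 𝟚 λ
      { 𝟘 o → ⊥-elim (¬p o) ; 𝟙 _ → inj₁ refl ; 𝟚 _ → inj₂ refl })
    ... | _ | no ¬q | _ = from-common (common-element 𝟘 𝟚 λ
      { 𝟘 _ → inj₁ refl ; 𝟙 o → ⊥-elim (¬q o) ; 𝟚 _ → inj₂ refl })
    ... | _ | _ | no ¬r = from-common (common-element 𝟘 𝟙 λ
      { 𝟘 _ → inj₁ refl ; 𝟙 _ → inj₂ refl ; 𝟚 o → ⊥-elim (¬r o) })

  -- The diamond condition

  Betweenᶜ : Fin 3 → CosetFace → CosetFace → CosetFace → Set ℓ
  Betweenᶜ j F H K = rankᶜ K ≡ at j × F <ᶜ K × K <ᶜ H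
    where open RankedStructure cosetStructure renaming (_<_ to _<ᶜ_)

  Diamond : Fin 3 → CosetFace → CosetFace → Set ℓ
  Diamond j F H = ∃[ A ] ∃[ B ] Betweenᶜ j F H A × Betweenᶜ j F H B × ¬ (A ≈ᶜ B) ×
                                (∀ K → Betweenᶜ j F H K → K ≈ᶜ A ⊎ K ≈ᶜ B)

  diamond₀ : ∀ h → Diamond 𝟘 bottom (coset 𝟙 h)
  diamond₀ h = coset 𝟘 h , coset 𝟘 (t ∙ h)
    , (refl , (bottom≤ , λ ()) , (coset≤ ℕ.z≤n (h , ~-refl , ~-refl) , λ ()))
    , (refl , (bottom≤ , λ ()) , (coset≤ ℕ.z≤n (t ∙ h , ~-refl , absorb h t∈) , λ ()))
    , (λ p → t≁ 𝟘 (λ ()) h (coset≈⁻¹ p))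
    , only
    where
    only : ∀ K → Betweenᶜ 𝟘 bottom (coset 𝟙 h) K → K ≈ᶜ coset 𝟘 h ⊎ K ≈ᶜ coset 𝟘 (t ∙ h)
    only K (r , _ , K≤ , _) with coset-of-rank K 𝟘 r
    ... | g , refl with coset≤⁻¹ K≤
    ... | x , x~g , x~h with ~₁-elements x~h
    ... | inj₁ x≈h  = inj₁ (coset≈ (~-trans (~-sym x~g) (≈⇒~ x≈h)))
    ... | inj₂ x≈th = inj₂ (coset≈ (~-trans (~-sym x~g) (≈⇒~ x≈th)))

  -- `x` is the only element common to H₀ g and H₂ k. An edge between them holds some `u` of the
  -- first and `v` of the second. If `v ≈ u`, then `u ≈ x`; if `v ≈ t ∙ u`, then `b ∙ u` is common,
  -- so `u ≈ b ⁻¹ ∙ x`, which is the second edge.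
  diamond₁ : ∀ {g k} → Meets 𝟘 g 𝟚 k → Diamond 𝟙 (coset 𝟘 g) (coset 𝟚 k)
  diamond₁ {g} {k} (x , x~g , x~k) = coset 𝟙 x , coset 𝟙 (b ⁻¹ ∙ x)
    , (refl , (coset≤ ℕ.z≤n (x , x~g , ~-refl) , λ ()) , (coset≤ (ℕ.s≤s ℕ.z≤n) (x , ~-refl , x~k) , λ ()))
    , (refl , (coset≤ ℕ.z≤n (b ⁻¹ ∙ x , ~-trans (b⁻¹~ x) x~g , ~-refl) , λ ())
            , (coset≤ (ℕ.s≤s ℕ.z≤n) (t ∙ (b ⁻¹ ∙ x) , absorb _ t∈ ,
                ~-trans (≈⇒~ (t∙b⁻¹ x)) (~-trans (absorb x a∈) x~k)) , λ ()))
    , (λ p → b⁻¹≁ x (coset≈⁻¹ p))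
    , only
    where
    only : ∀ K → Betweenᶜ 𝟙 (coset 𝟘 g) (coset 𝟚 k) K → K ≈ᶜ coset 𝟙 x ⊎ K ≈ᶜ coset 𝟙 (b ⁻¹ ∙ x)
    only K (r , (≤K , _) , (K≤ , _)) with coset-of-rank K 𝟙 r
    ... | y , refl with coset≤⁻¹ ≤K | coset≤⁻¹ K≤
    ... | u , u~g , u~y | v , v~y , v~k with ~₁-elements (~-trans v~y (~-sym u~y))
    ... | inj₁ v≈u = inj₁ (coset≈ (~-trans (~-sym u~y) (≈⇒~ u≈x)))
      where
      u≈x : u ≈ x
      u≈x = ~-separates {𝟘} {𝟚} (λ ()) (~-trans u~g (~-sym x~g))
        (~-trans (≈⇒~ (≈-sym v≈u)) (~-trans v~k (~-sym x~k)))
    ... | inj₂ v≈tu = inj₂ (coset≈ (~-trans (~-sym u~y) (≈⇒~ (≈-trans (≈-sym (b⁻¹∙b u)) (∙-congˡ bu≈x)))))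
      where
      bu≈x : b ∙ u ≈ x
      bu≈x = ~-separates {𝟘} {𝟚} (λ ()) (~-trans (absorb u b∈) (~-trans u~g (~-sym x~g)))
        (~-trans (~-sym (t~b u)) (~-trans (≈⇒~ (≈-sym v≈tu)) (~-trans v~k (~-sym x~k))))

  diamond₂ : ∀ h → Diamond 𝟚 (coset 𝟙 h) top
  diamond₂ h = coset 𝟚 h , coset 𝟚 (t ∙ h)
    , (refl , (coset≤ (ℕ.s≤s ℕ.z≤n) (h , ~-refl , ~-refl) , λ ()) , (≤top , λ ()))
    , (refl , (coset≤ (ℕ.s≤s ℕ.z≤n) (t ∙ h , absorb h t∈ , ~-refl) , λ ()) , (≤top , λ ()))
    , (λ p → t≁ 𝟚 (λ ()) h (coset≈⁻¹ p))
    , only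
    where
    only : ∀ K → Betweenᶜ 𝟚 (coset 𝟙 h) top K → K ≈ᶜ coset 𝟚 h ⊎ K ≈ᶜ coset 𝟚 (t ∙ h)
    only K (r , (≤K , _) , _) with coset-of-rank K 𝟚 r
    ... | g , refl with coset≤⁻¹ ≤K
    ... | x , x~h , x~g with ~₁-elements x~h
    ... | inj₁ x≈h  = inj₁ (coset≈ (~-trans (~-sym x~g) (≈⇒~ x≈h)))
    ... | inj₂ x≈th = inj₂ (coset≈ (~-trans (~-sym x~g) (≈⇒~ x≈th)))

  diamondᶜ : ∀ j {F H} → rankᶜ F ≡ below j → rankᶜ H ≡ above j → F ≤ᶜ H × ¬ (F ≈ᶜ H) → Diamond j F H
  diamondᶜ 𝟘 {F} {H} p q _ with rankᶜ≡0 F p | coset-of-rank H 𝟙 q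
  ... | refl | h , refl = diamond₀ h
  diamondᶜ 𝟙 {F} {H} p q (F≤H , _) with coset-of-rank F 𝟘 p | coset-of-rank H 𝟚 q
  ... | g , refl | k , refl = diamond₁ (coset≤⁻¹ F≤H)
  diamondᶜ 𝟚 {F} {H} p q _ with coset-of-rank F 𝟙 p | rankᶜ≡4 H q
  ... | h , refl | refl = diamond₂ h

  isPolytopeᶜ : IsPolytope cosetStructure
  isPolytopeᶜ = record
    { isPartialOrder        = ≤ᶜ-isPartialOrder
    ; rank-cong             = rankᶜ-cong
    ; rank-strict           = rankᶜ-strict
    ; least                 = bottom , refl , λ _ → bottom≤
    ; greatest              = top , refl , λ _ → ≤top
    ; flags                 = flagsᶜ
    ; diamond               = diamondᶜ
    ; stronglyFlagConnected = stronglyConnectedᶜ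
    }

  -- Right translations

  translateᶜ : Carrier → CosetFace → CosetFace
  translateᶜ g bottom      = bottom
  translateᶜ g top         = top
  translateᶜ g (coset j x) = coset j (x ∙ g)

  translateᶜ-cong : ∀ g {F H} → F ≈ᶜ H → translateᶜ g F ≈ᶜ translateᶜ g H
  translateᶜ-cong g bottom≈    = bottom≈
  translateᶜ-cong g top≈       = top≈
  translateᶜ-cong g (coset≈ p) = coset≈ (~-∙ʳ g p)

  translateᶜ-mono : ∀ g {F H} → F ≤ᶜ H → translateᶜ g F ≤ᶜ translateᶜ g H
  translateᶜ-mono g bottom≤                    = bottom≤
  translateᶜ-mono g ≤top                       = ≤top
  translateᶜ-mono g (coset≤ i≤j (x , p , q)) = coset≤ i≤j (x ∙ g , ~-∙ʳ g p , ~-∙ʳ g q)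

  translateᶜ-≈ε : ∀ g h → g ∙ h ≈ e → ∀ F → translateᶜ h (translateᶜ g F) ≈ᶜ F
  translateᶜ-≈ε g h gh≈e bottom      = bottom≈
  translateᶜ-≈ε g h gh≈e top         = top≈
  translateᶜ-≈ε g h gh≈e (coset j x) =
    coset≈ (≈⇒~ (≈-trans (assoc x g h) (≈-trans (∙-congˡ gh≈e) (identityʳ x))))

  translate : Carrier → Automorphism cosetStructure
  translate g = record
    { to = translateᶜ g
    ; isOrderIsomorphism = record
      { isOrderMonomorphism = record
        { isOrderHomomorphism = record { cong = translateᶜ-cong g ; mono = translateᶜ-mono g }
        ; injective = λ {F} {H} p →
            ≈ᶜ-trans (≈ᶜ-sym (undo F)) (≈ᶜ-trans (translateᶜ-cong (g ⁻¹) p) (undo H))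
        ; cancel = λ {F} {H} p → ≤ᶜ-trans (≤ᶜ-reflexive (≈ᶜ-sym (undo F)))
            (≤ᶜ-trans (translateᶜ-mono (g ⁻¹) p) (≤ᶜ-reflexive (undo H)))
        }
      ; surjective = λ F → translateᶜ (g ⁻¹) F ,
          λ p → ≈ᶜ-trans (translateᶜ-cong g p) (translateᶜ-≈ε (g ⁻¹) g (inverseˡ g) F)
      }
    }
    where
    undo : ∀ F → translateᶜ (g ⁻¹) (translateᶜ g F) ≈ᶜ F
    undo = translateᶜ-≈ε g (g ⁻¹) (inverseʳ g)

  -- Flag orbits: chiral or directly regular

  module Orbits (isPolytope : IsPolytope cosetStructure) where
    cosetPolyhedron : Polyhedron ℓ
    cosetPolyhedron = polytope cosetStructure isPolytope

    open PolytopeProperties em cosetPolyhedron hiding (_≋_)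
    open Rotations em cosetPolyhedron baseFlag using (σ-regular-rotates)
    open Automorphism
    private module Γ = Group (Γ cosetPolyhedron)

    translate-even : ∀ x → image (translate x) (even e) ≋ even x
    translate-even x = ≋-cosets {image (translate x) (even e)} {even x} λ
      { 𝟘 → coset≈ (≈⇒~ (identityˡ x)) ; 𝟙 → coset≈ (≈⇒~ (identityˡ x)) ; 𝟚 → coset≈ (≈⇒~ (identityˡ x)) }

    translate-odd : ∀ x → image (translate x) (odd e) ≋ odd x
    translate-odd x = ≋-cosets {image (translate x) (odd e)} {odd x} λ
      { 𝟘 → coset≈ (≈⇒~ (identityˡ x))
      ; 𝟙 → coset≈ (≈⇒~ (identityˡ x))
      ; 𝟚 → coset≈ (≈⇒~ (∙-congʳ (identityʳ b))) }

    baseFlag≋even : baseFlag ≋ even e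
    baseFlag≋even = ≋-cosets {baseFlag} {even e} λ { 𝟘 → ≈ᶜ-refl ; 𝟙 → ≈ᶜ-refl ; 𝟚 → ≈ᶜ-refl }

    even-orbit : ∀ {X} → IsEven X → SameOrbit cosetStructure (even e) X
    even-orbit (x , p) = translate x , λ i → ≈ᶜ-trans (translate-even x i) (≈ᶜ-sym (p i))

    odd-orbit : ∀ {X} → IsOdd X → SameOrbit cosetStructure (odd e) X
    odd-orbit (x , p) = translate x , λ i → ≈ᶜ-trans (translate-odd x i) (≈ᶜ-sym (p i))

    even⇒odd : ∀ {j X Y} → AdjacentAt cosetStructure j X Y → IsEven X → IsOdd Y
    even⇒odd {j} adj (x , p) = across j x , adjacentAt-unique p adj (even-across j x)

    odd⇒even : ∀ {j X Y} → AdjacentAt cosetStructure j X Y → IsOdd X → IsEven Y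
    odd⇒even {j} adj (x , p) = across⁻¹ j x , adjacentAt-unique p adj (odd-across j x)

    chiralᶜ : ¬ SameOrbit cosetStructure (even e) (odd e) → Chiral cosetPolyhedron
    chiralᶜ distinct = record
      { orbit₁          = even e
      ; orbit₂          = odd e
      ; orbits-distinct = distinct
      ; orbits-cover    = λ X → [ (λ p → inj₁ (even-orbit {X} p)) , (λ p → inj₂ (odd-orbit {X} p)) ]′ (even-or-odd X)
      ; adjacent-differ = differ
      }
      where
      not-joined : ∀ {X Y} → IsEven X → IsOdd Y → ¬ SameOrbit cosetStructure X Y
      not-joined {X} {Y} p q XY = distinct (sameOrbit-trans {even e} {X} {odd e} (even-orbit {X} p)
        (sameOrbit-trans {X} {Y} {odd e} XY (sameOrbit-sym {odd e} {Y} (odd-orbit {Y} q))))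
      differ : ∀ X Y → Adjacent cosetStructure X Y → ¬ SameOrbit cosetStructure X Y
      differ X Y adj XY with adjacent⇒adjacentAt {X} {Y} adj | even-or-odd X
      ... | j , XYⱼ | inj₁ p = not-joined {X} {Y} p (even⇒odd XYⱼ p) XY
      ... | j , XYⱼ | inj₂ p = not-joined {Y} {X} (odd⇒even XYⱼ p) p (sameOrbit-sym {X} {Y} XY)

    regularᶜ : SameOrbit cosetStructure (even e) (odd e) → Regular cosetPolyhedron
    regularᶜ joined X Y =
      sameOrbit-trans {X} {even e} {Y} (sameOrbit-sym {even e} {X} (one-orbit X)) (one-orbit Y)
      where
      one-orbit : ∀ X → SameOrbit cosetStructure (even e) X
      one-orbit X with even-or-odd X
      ... | inj₁ p = even-orbit {X} p
      ... | inj₂ p = sameOrbit-trans {even e} {odd e} {X} joined (odd-orbit {X} p)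

    module _ (regular : Regular cosetPolyhedron) where
      private
        θ = proj₁ (regular (even e) (odd e))
        θ-maps = proj₂ (regular (even e) (odd e))
        σᶜ = σ-regular cosetPolyhedron baseFlag regular
        Γ⁺ᶜ = Generated (Γ cosetPolyhedron) σᶜ

      -- Adjacent flags have opposite parity, so θ reverses the parity of all flags.
      θ-flips : ∀ X → (IsEven X × IsOdd (image θ X)) ⊎ (IsOdd X × IsEven (image θ X))
      θ-flips X = connected-induction
        (λ X → (IsEven X × IsOdd (image θ X)) ⊎ (IsOdd X × IsEven (image θ X)))
        (λ {X} {Y} X≋Y →
          let θX≋θY = λ i → to-cong θ (X≋Y i)
              move : ∀ {A B C} → A ≋ B → A ≋ C → B ≋ C
              move A≋B A≋C i = ≈ᶜ-trans (≈ᶜ-sym (A≋B i)) (A≋C i)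
          in λ { (inj₁ ((x , p) , (y , q))) →
                   inj₁ ((x , move {X} {Y} {even x} X≋Y p) , (y , move {image θ X} {image θ Y} {odd y} θX≋θY q))
               ; (inj₂ ((x , p) , (y , q))) →
                   inj₂ ((x , move {X} {Y} {odd x} X≋Y p) , (y , move {image θ X} {image θ Y} {even y} θX≋θY q)) })
        (λ adj → λ { (inj₁ (p , q)) → inj₂ (even⇒odd adj p , odd⇒even (image-adjacentAt θ adj) q)
                   ; (inj₂ (p , q)) → inj₁ (odd⇒even adj p , even⇒odd (image-adjacentAt θ adj) q) })
        (even e) X (inj₁ ((e , λ _ → ≈ᶜ-refl) , (e , θ-maps)))

      -- By rigidity the images of the base flag suffice: following the moves at ranks k + 1 and k
      -- through `across` and `across⁻¹` ends at `even (s k)`.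
      σᶜ≈translate : ∀ k → σᶜ k Γ.≈ translate (s k)
      σᶜ≈translate k = rigid {σᶜ k} {translate (s k)} baseFlag λ i → ≈ᶜ-trans (maps k i)
        (≈ᶜ-trans (≈ᶜ-sym (translate-even (s k) i)) (translateᶜ-cong (s k) (≈ᶜ-sym (baseFlag≋even i))))
        where
        maps : ∀ k → image (σᶜ k) baseFlag ≋ even (s k)
        maps 𝟘 with σ-regular-rotates regular 𝟘
        ... | Y , p , q = λ i → ≈ᶜ-trans
          (adjacentAt-unique (adjacentAt-unique baseFlag≋even p (even-across 𝟙 e)) q (odd-across 𝟘 (b ⁻¹ ∙ e)) i)
          (even-cong (≈-trans (t∙b⁻¹ e) (identityʳ a)) i)
        maps 𝟙 with σ-regular-rotates regular 𝟙
        ... | Y , p , q = λ i → ≈ᶜ-trans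
          (adjacentAt-unique (adjacentAt-unique baseFlag≋even p (even-across 𝟚 e)) q (odd-across 𝟙 e) i)
          (even-cong (identityʳ b) i)

      translate-cong : ∀ {x y} → x ≈ y → translate x Γ.≈ translate y
      translate-cong x≈y bottom      = bottom≈
      translate-cong x≈y top         = top≈
      translate-cong x≈y (coset j z) = coset≈ (≈⇒~ (∙-congˡ x≈y))

      translate-ε : translate e Γ.≈ Γ.ε
      translate-ε bottom      = bottom≈
      translate-ε top         = top≈
      translate-ε (coset j z) = coset≈ (≈⇒~ (identityʳ z))

      translate-∙ : ∀ x y → translate (x ∙ y) Γ.≈ (translate x Γ.∙ translate y)
      translate-∙ x y bottom      = bottom≈
      translate-∙ x y top         = top≈
      translate-∙ x y (coset j z) = coset≈ (≈⇒~ (≈-sym (assoc z x y)))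

      translate-⁻¹ : ∀ x → translate (x ⁻¹) Γ.≈ (translate x Γ.⁻¹)
      translate-⁻¹ x F = ≈ᶜ-refl

      translate∈Γ⁺ : ∀ {g} → Generated G s g → Γ⁺ᶜ (translate g)
      translate∈Γ⁺ (gen k)        = resp (σᶜ≈translate k) (gen k)
      translate∈Γ⁺ unit           = resp (Γ.sym {translate e} {Γ.ε} translate-ε) unit
      translate∈Γ⁺ (mul {x} {y} p q) =
        resp (Γ.sym {translate (x ∙ y)} {translate x Γ.∙ translate y} (translate-∙ x y))
          (mul (translate∈Γ⁺ p) (translate∈Γ⁺ q))
      translate∈Γ⁺ (inv {x} p)    = resp (translate-⁻¹ x) (inv (translate∈Γ⁺ p))
      translate∈Γ⁺ (resp x≈y p)   = resp (translate-cong x≈y) (translate∈Γ⁺ p)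

      Γ⁺-translates : ∀ {γ} → Γ⁺ᶜ γ → ∃[ g ] γ Γ.≈ translate g
      Γ⁺-translates (gen k) = s k , σᶜ≈translate k
      Γ⁺-translates unit = e , λ F → ≈ᶜ-sym (translate-ε F)
      Γ⁺-translates (mul {γ} {δ} p q) with Γ⁺-translates p | Γ⁺-translates q
      ... | x , γ≈ | y , δ≈ = x ∙ y , λ F → ≈ᶜ-trans (to-cong δ (γ≈ F))
        (≈ᶜ-trans (δ≈ (translateᶜ x F)) (≈ᶜ-sym (translate-∙ x y F)))
      Γ⁺-translates (inv {γ} p) with Γ⁺-translates p
      ... | x , γ≈ = x ⁻¹ , Γ.⁻¹-cong {γ} {translate x} γ≈
      Γ⁺-translates (resp γ≈δ p) with Γ⁺-translates p
      ... | x , γ≈ = x , λ F → ≈ᶜ-trans (≈ᶜ-sym (γ≈δ F)) (γ≈ F)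

      -- Translations are transitive on even flags, so one of them agrees with `γ` on a flag and
      -- hence everywhere.
      even⇒Γ⁺ : ∀ γ → IsEven (image γ (even e)) → Γ⁺ᶜ γ
      even⇒Γ⁺ γ (x , p) = resp
        (rigid {translate x} {γ} (even e) (λ i → ≈ᶜ-trans (translate-even x i) (≈ᶜ-sym (p i))))
        (translate∈Γ⁺ (generated x))

      θ∉Γ⁺ : ¬ Γ⁺ᶜ θ
      θ∉Γ⁺ θ∈ with Γ⁺-translates θ∈
      ... | x , θ≈ = even∧odd {image θ (even e)}
        (x , λ i → ≈ᶜ-trans (θ≈ (face (even e) i)) (translate-even x i)) (e , θ-maps)

      θ⁻¹∉Γ⁺ : ¬ Γ⁺ᶜ (θ Γ.⁻¹)
      θ⁻¹∉Γ⁺ p = θ∉Γ⁺ (resp {x = θ Γ.⁻¹ Γ.⁻¹} {y = θ} (⁻¹-involutive′ θ) (inv p))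
        where open GroupProperties (Γ cosetPolyhedron) using () renaming (⁻¹-involutive to ⁻¹-involutive′)

      -- Applying `θ` to the image of `even e` under γθ⁻¹ gives back the odd image under `γ`; since
      -- `θ` reverses parity, that flag was even.
      odd⇒Γ⁺θ : ∀ γ → IsOdd (image γ (even e)) → Γ⁺ᶜ (γ Γ.∙ θ Γ.⁻¹)
      odd⇒Γ⁺θ γ (x , p) = even⇒Γ⁺ (γ Γ.∙ θ Γ.⁻¹) (parity (θ-flips Y))
        where
        Y = image (γ Γ.∙ θ Γ.⁻¹) (even e)
        parity : (IsEven Y × IsOdd (image θ Y)) ⊎ (IsOdd Y × IsEven (image θ Y)) → IsEven Y
        parity (inj₁ (q , _)) = q
        parity (inj₂ (_ , q)) = even∧odd {image θ Y} q
          (x , λ i → ≈ᶜ-trans (Γ.inverseˡ θ (to γ (face (even e) i))) (p i))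

      reps : Fin 2 → Automorphism cosetStructure
      reps 𝟘 = Γ.ε
      reps 𝟙 = θ

      covers : ∀ γ → ∃[ i ] Γ⁺ᶜ (γ Γ.∙ reps i Γ.⁻¹)
      covers γ = go (even-or-odd (image γ (even e)))
        where
        go : IsEven (image γ (even e)) ⊎ IsOdd (image γ (even e)) → ∃[ i ] Γ⁺ᶜ (γ Γ.∙ reps i Γ.⁻¹)
        go (inj₁ (x , p)) = 𝟘 , even⇒Γ⁺ (γ Γ.∙ reps 𝟘 Γ.⁻¹) (x , p)
        go (inj₂ p)       = 𝟙 , odd⇒Γ⁺θ γ p

      distinct : ∀ i j → Γ⁺ᶜ (reps i Γ.∙ reps j Γ.⁻¹) → i ≡ j
      distinct 𝟘 𝟘 _ = refl
      distinct 𝟘 𝟙 p = ⊥-elim (θ⁻¹∉Γ⁺ (resp {x = reps 𝟘 Γ.∙ reps 𝟙 Γ.⁻¹} {y = θ Γ.⁻¹} (λ _ → ≈ᶜ-refl) p))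
      distinct 𝟙 𝟘 p = ⊥-elim (θ∉Γ⁺ (resp {x = reps 𝟙 Γ.∙ reps 𝟘 Γ.⁻¹} {y = θ} (λ _ → ≈ᶜ-refl) p))
      distinct 𝟙 𝟙 _ = refl

      directlyRegularᶜ : DirectlyRegular cosetPolyhedron baseFlag
      directlyRegularᶜ = record { regular = regular ; index-2 = reps , covers , distinct }

    chiral-or-directlyRegularᶜ : ChiralOrDirectlyRegular cosetPolyhedron baseFlag
    chiral-or-directlyRegularᶜ with em {SameOrbit cosetStructure (even e) (odd e)}
    ... | yes joined  = inj₂ (directlyRegularᶜ (regularᶜ joined))
    ... | no distinct = inj₁ (chiralᶜ distinct)

corollary3p7 : ∀ {ℓ : Level} → ExcludedMiddle ℓ →
    (P : Polyhedron ℓ) (Φ : Flag (Polytope.structure P)) (hP : ChiralOrDirectlyRegular P Φ)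
    (Q : Polyhedron ℓ) (Ψ : Flag (Polytope.structure Q)) (hQ : ChiralOrDirectlyRegular Q Ψ) →
    let open Mix P Φ hP Q Ψ hQ in
    Σ[ isPolyhedron ∈ IsPolytope P◇Q ]
    ChiralOrDirectlyRegular (polytope P◇Q isPolyhedron) P◇Q-baseFlag
corollary3p7 em P Φ hP Q Ψ hQ = isPolytopeᶜ , Orbits.chiral-or-directlyRegularᶜ isPolytopeᶜ
  where
  open Mix P Φ hP Q Ψ hQ
  open PolyhedralCosetGeometry em mixGroup mixGenerators
    (mix-isPolyhedralRotation em P Φ hP Q Ψ hQ)
    (λ (_ , p) → generatedGroup-generated Γ⁺P×Γ⁺Q β p)
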